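{- Let $g\ge3$, $d\ge3$, and let $S_{g,d}$ be the cycle $C_g$ with $d-2$ pendant leaves at each cycle vertex. Then $S_{g,d}$ admits no discrete Einstein metric with a non-geodesic cycle edge, i.e. no discrete Einstein metric $w$ in which some cycle edge has weight strictly greater than $\tfrac12L$, where $L$ is the total weight of the cycle edges.
   Context: Weighted graphs: $G=(V,E)$ is a finite connected simple graph, $w:E\to\mathbb{R}_{>0}$ an edge weighting, $d_v$ the combinatorial degree, and $d(x,y)$ the least total weight of a path from $x$ to $y$. Lin--Lu--Yau curvature: for $\alpha\in[0,1]$ let $\mu_x^\alpha$ be the probability measure with mass $\alpha$ at $x$ and $(1-\alpha)/d_x$ at each neighbour of $x$. Let $W$ be the $L^1$-Wasserstein distance with respect to $d$. For an edge $x\sim y$ put $\kappa_\alpha(x,y)=1-W(\mu_x^\alpha,\mu_y^\alpha)/d(x,y)$ (note the normalisation by the distance $d(x,y)$, not the edge weight) and $\kappa_{xy}=\lim_{\alpha\to1}\kappa_\alpha(x,y)/(1-\alpha)$. A positive weighting $w$ is a discrete Einstein metric if there is a real $\kappa$ with $\kappa_e=\kappa$ for every edge $e$. -}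

module Defs where

open import Algebra.Apartness.Bundles using (HeytingField; HeytingCommutativeRing)
open import Algebra.Bundles using (CommutativeRing)
import Algebra.Definitions.RawMonoid as RawMonoidDefinitions
import Algebra.Properties.Monoid.Sum as MonoidSum
import Algebra.Properties.Ring as RingProperties
open import Data.Empty using (⊥)
open import Data.Fin.Base using (Fin; zero; suc; toℕ)
open import Data.Fin.Properties using (+↔⊎; *↔×; toℕ<n; toℕ-fromℕ<; toℕ-injective)
import Data.Fin.Properties as Fin
open import Data.List.Base using (filter; length; tabulate)
open import Data.Nat.Base as ℕ using (ℕ; zero; suc; z≤n; s≤s)
open import Data.Nat.DivMod using (_mod_; _%_; n%n≡0; m<n⇒m%n≡m; %-distribˡ-+; m%n%n≡m%n)
import Data.Nat.Properties as ℕ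
open import Data.Product using (∃; ∃-syntax; Σ; _×_; _,_; proj₁)
open import Data.Product.Properties using () renaming (≡-dec to ×-≡-dec)
open import Data.Sum using (_⊎_; inj₁; inj₂; swap)
open import Data.Sum.Function.Propositional using (_⊎-↔_)
open import Data.Sum.Properties using () renaming (≡-dec to ⊎-≡-dec)
open import Function.Base using (_∘_)
open import Function.Bundles using (_↔_; Inverse)
open import Function.Construct.Composition using (_↔-∘_)
open import Function.Construct.Identity using (↔-id)
open import Level using (Level; _⊔_)
open import Relation.Binary.Construct.Closure.ReflexiveTransitive using (Star; ε; _◅_; _◅◅_; reverse)
open import Relation.Binary.Definitions using (Decidable; DecidableEquality; Irreflexive; Symmetric)
open import Relation.Binary.PropositionalEquality as ≡ using (_≡_; _≢_; cong; subst)
open import Relation.Binary.Structures using (IsStrictPartialOrder)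
open import Relation.Nullary using (¬_; yes; no; contradiction)
open import Relation.Nullary.Decidable using (_⊎-dec_)

------------------------------------------------------------------------
-- Real numbers

-- The library has no real numbers, so they are axiomatised as a Cauchy
-- complete Archimedean ordered field.  The axioms are phrased with _<_
-- and apartness so as not to presuppose decidability of the order;
-- classically any two models are isomorphic.

record RealNumbers (c ℓ₁ ℓ₂ : Level) : Set (Level.suc (c ⊔ ℓ₁ ⊔ ℓ₂)) where
  infix 4 _<_ _≤_
  infix 8 1/_

  field
    heytingField : HeytingField c ℓ₁ ℓ₂

  open HeytingField heytingField public

  commutativeRing : CommutativeRing c ℓ₁
  commutativeRing =
    HeytingCommutativeRing.commutativeRing
      (HeytingField.heytingCommutativeRing heytingField)

  open RawMonoidDefinitions
    (CommutativeRing.+-rawMonoid commutativeRing)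
    using () renaming (_×_ to _·_) public

  fromℕ : ℕ → Carrier
  fromℕ n = n · 1#

  field
    _<_                  : Carrier → Carrier → Set ℓ₂
    isStrictPartialOrder : IsStrictPartialOrder _≈_ _<_
    #⇒<⊎>                : ∀ {x y} → x # y → x < y ⊎ y < x
    <⇒#                  : ∀ {x y} → x < y → x # y
    0<1                  : 0# < 1#
    +-monoˡ-<            : ∀ {x y} z → x < y → x + z < y + z
    *-pos                : ∀ {x y} → 0# < x → 0# < y → 0# < x * y
    archimedean          : ∀ x → ∃[ n ] x < fromℕ n

  _≤_ : Carrier → Carrier → Set ℓ₂
  x ≤ y = ¬ (y < x)

  -- | x - y | < δ
  Within : Carrier → Carrier → Carrier → Set ℓ₂
  Within δ x y = (x - y < δ) × (y - x < δ)

  IsCauchy : (ℕ → Carrier) → Set (c ⊔ ℓ₂)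
  IsCauchy s = ∀ δ → 0# < δ →
    ∃[ N ] (∀ m n → N ℕ.≤ m → N ℕ.≤ n → Within δ (s m) (s n))

  ConvergesTo : (ℕ → Carrier) → Carrier → Set (c ⊔ ℓ₂)
  ConvergesTo s l = ∀ δ → 0# < δ →
    ∃[ N ] (∀ n → N ℕ.≤ n → Within δ (s n) l)

  field
    complete : ∀ s → IsCauchy s → ∃[ l ] ConvergesTo s l

  open IsStrictPartialOrder isStrictPartialOrder public
    using (<-respˡ-≈; <-respʳ-≈)
    renaming (trans to <-trans; irrefl to <-irrefl)

  open MonoidSum (CommutativeRing.+-monoid commutativeRing) public
    using (sum)

  inverse : ∀ x → 0# < x → Carrier
  inverse x 0<x = proj₁ (#⇒invertible (#-sym (<⇒# 0<x)))

  x+y-pos : ∀ {x y} → 0# < x → 0# < y → 0# < x + y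
  x+y-pos {x} {y} 0<x 0<y =
    <-trans 0<y (<-respˡ-≈ (+-identityˡ y) (+-monoˡ-< y 0<x))

  x<y⇒0<y-x : ∀ {x y} → x < y → 0# < y - x
  x<y⇒0<y-x {x} x<y = <-respˡ-≈ (-‿inverseʳ x) (+-monoˡ-< (- x) x<y)

  0<fromℕ : ∀ n → 0# < fromℕ (suc n)
  0<fromℕ zero    = <-respʳ-≈ (sym (+-identityʳ 1#)) 0<1
  0<fromℕ (suc n) = x+y-pos 0<1 (0<fromℕ n)

  -- 1/ 0 is a junk value, used only for the degree of an isolated vertex.
  1/_ : ℕ → Carrier
  1/ zero  = 0#
  1/ suc n = inverse (fromℕ (suc n)) (0<fromℕ n)

  -- Infimum of the set of values satisfying P.
  IsInfimum : ∀ {p} → (Carrier → Set p) → Carrier → Set (c ⊔ ℓ₂ ⊔ p)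
  IsInfimum P m =
    (∀ x → P x → m ≤ x) × (∀ b → (∀ x → P x → b ≤ x) → b ≤ m)

------------------------------------------------------------------------
-- Finite connected simple graphs

record Graph : Set₁ where
  infix 4 _~_ _~?_ _≟_
  field
    V           : Set
    order       : ℕ
    enumeration : Fin order ↔ V
    _≟_         : DecidableEquality V
    _~_         : V → V → Set
    _~?_        : Decidable _~_
    ~-sym       : Symmetric _~_
    ~-irrefl    : Irreflexive _≡_ _~_
    connected   : ∀ x y → Star _~_ x y

  vertex : Fin order → V
  vertex = Inverse.to enumeration

  degree : V → ℕ
  degree x = length (filter (x ~?_) (tabulate vertex))

  -- Walks are finite sequences of adjacent vertices; repetitions do not
  -- affect the least total weight because the edge weights are positive.
  Walk : V → V → Set
  Walk = Star _~_

  ~⇒≢ : ∀ {x y} → x ~ y → x ≢ y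
  ~⇒≢ x~y x≡y = ~-irrefl x≡y x~y

------------------------------------------------------------------------
-- Weightings and Lin–Lu–Yau curvature

module _ {c ℓ₁ ℓ₂} (ℝ : RealNumbers c ℓ₁ ℓ₂) (G : Graph) where
  open RealNumbers ℝ
  open Graph G

  -- The values of weight at non-adjacent pairs are irrelevant.
  record Weighting : Set (c ⊔ ℓ₁ ⊔ ℓ₂) where
    field
      weight     : V → V → Carrier
      weight-sym : ∀ {x y} → x ~ y → weight x y ≈ weight y x
      weight-pos : ∀ {x y} → x ~ y → 0# < weight x y

    walkWeight : ∀ {x y} → Walk x y → Carrier
    walkWeight ε                 = 0#
    walkWeight (_◅_ {x} {y} _ p) = weight x y + walkWeight p

    walkWeight-pos : ∀ {x y} (p : Walk x y) → x ≢ y → 0# < walkWeight p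
    walkWeight-pos ε             x≢x = contradiction ≡.refl x≢x
    walkWeight-pos (e ◅ ε)       _   =
      <-respʳ-≈ (sym (+-identityʳ _)) (weight-pos e)
    walkWeight-pos (e ◅ f ◅ p)   _   = x+y-pos (weight-pos e) (tail-pos f p)
      where
      tail-pos : ∀ {x y z} (f : x ~ y) (p : Walk y z) → 0# < walkWeight (f ◅ p)
      tail-pos f ε        = <-respʳ-≈ (sym (+-identityʳ _)) (weight-pos f)
      tail-pos f (e′ ◅ q) = x+y-pos (weight-pos f) (tail-pos e′ q)

  record Distance (w : Weighting) : Set (c ⊔ ℓ₁ ⊔ ℓ₂) where
    open Weighting w
    field
      dist     : V → V → Carrier
      attained : ∀ x y → ∃[ p ] walkWeight {x} {y} p ≈ dist x y
      minimal  : ∀ {x y} (p : Walk x y) → dist x y ≤ walkWeight p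

    dist-pos : ∀ {x y} → x ≢ y → 0# < dist x y
    dist-pos {x} {y} x≢y with p , eq ← attained x y =
      <-respʳ-≈ eq (walkWeight-pos p x≢y)

  ∑ᵥ : (V → Carrier) → Carrier
  ∑ᵥ f = sum (f ∘ vertex)

  -- The measure μ_x^α, given by its mass at each vertex.
  μ : Carrier → V → V → Carrier
  μ α x y with x ≟ y | x ~? y
  ... | yes _ | _     = α
  ... | no _  | yes _ = (1# - α) * 1/ degree x
  ... | no _  | no _  = 0#

  record Coupling (ρ σ : V → Carrier) : Set (c ⊔ ℓ₁ ⊔ ℓ₂) where
    field
      π         : V → V → Carrier
      π-nonneg  : ∀ x y → 0# ≤ π x y
      marginal₁ : ∀ x → ∑ᵥ (λ y → π x y) ≈ ρ x
      marginal₂ : ∀ y → ∑ᵥ (λ x → π x y) ≈ σ y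

  module _ {w : Weighting} (D : Distance w) where
    open Distance D

    cost : ∀ {ρ σ} → Coupling ρ σ → Carrier
    cost C = ∑ᵥ λ x → ∑ᵥ λ y → dist x y * Coupling.π C x y

    -- W(ρ,σ) = m
    IsWasserstein : (ρ σ : V → Carrier) → Carrier → Set (c ⊔ ℓ₁ ⊔ ℓ₂)
    IsWasserstein ρ σ = IsInfimum λ t → ∃[ C ] cost {ρ} {σ} C ≈ t

    -- κ_α(x,y) = k
    IsCurvatureAt : Carrier → ∀ {x y} → x ~ y → Carrier → Set (c ⊔ ℓ₁ ⊔ ℓ₂)
    IsCurvatureAt α {x} {y} x~y k =
      ∃[ m ] IsWasserstein (μ α x) (μ α y) m ×
             k ≈ 1# - m * inverse (dist x y) (dist-pos (~⇒≢ x~y))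

    -- κ_{xy} = κ, as a limit α → 1 within [0,1)
    IsCurvature : ∀ {x y} → x ~ y → Carrier → Set (c ⊔ ℓ₁ ⊔ ℓ₂)
    IsCurvature x~y κ =
      ∀ δ → 0# < δ → ∃[ η ] 0# < η ×
        (∀ α → 0# ≤ α → (α<1 : α < 1#) → 1# - η < α →
          ∃[ k ] IsCurvatureAt α x~y k ×
                 Within δ (k * inverse (1# - α) (x<y⇒0<y-x α<1)) κ)

  IsEinstein : Weighting → Set (c ⊔ ℓ₁ ⊔ ℓ₂)
  IsEinstein w =
    Σ (Distance w) λ D →
      ∃[ κ ] (∀ {x y} (x~y : x ~ y) → IsCurvature D x~y κ)

------------------------------------------------------------------------
-- The cycle C_g with d - 2 pendant leaves at each vertex

next : ∀ {g} → Fin g → Fin g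
next {suc n} i = suc (toℕ i) mod suc n

next≢ : ∀ {g} → 3 ℕ.≤ g → (i : Fin g) → i ≢ next i
next≢ {suc n} (s≤s 2≤n) i i≡ with suc (toℕ i) ℕ.≟ suc n
... | yes eq = contradiction (≡.trans (≡.sym (ℕ.suc-injective eq)) i≡0)
                 (ℕ.>⇒≢ (ℕ.<-≤-trans (s≤s z≤n) 2≤n))
  where
  i≡0 : toℕ i ≡ 0
  i≡0 = ≡.trans (cong toℕ i≡) (≡.trans (toℕ-fromℕ< _)
          (≡.trans (cong (_% suc n) eq) (n%n≡0 (suc n))))
... | no neq = ℕ.1+n≢n (≡.sym (≡.trans (cong toℕ i≡) (≡.trans (toℕ-fromℕ< _)
                 (m<n⇒m%n≡m (ℕ.≤∧≢⇒< (toℕ<n i) neq)))))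

mod-next : ∀ k n → next (k mod suc n) ≡ suc k mod suc n
mod-next k n = toℕ-injective (begin
  toℕ (next (k mod suc n))                    ≡⟨ toℕ-fromℕ< _ ⟩
  suc (toℕ (k mod suc n)) % suc n             ≡⟨ cong (λ j → suc j % suc n) (toℕ-fromℕ< _) ⟩
  (1 ℕ.+ k % suc n) % suc n                   ≡⟨ %-distribˡ-+ 1 (k % suc n) (suc n) ⟩
  (1 % suc n ℕ.+ k % suc n % suc n) % suc n   ≡⟨ cong (λ j → (1 % suc n ℕ.+ j) % suc n) (m%n%n≡m%n k (suc n)) ⟩
  (1 % suc n ℕ.+ k % suc n) % suc n           ≡⟨ %-distribˡ-+ 1 k (suc n) ⟨
  suc k % suc n                               ≡⟨ toℕ-fromℕ< _ ⟨
  toℕ (suc k mod suc n)                       ∎)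
  where open ≡.≡-Reasoning

toℕ-mod : ∀ {n} (i : Fin (suc n)) → toℕ i mod suc n ≡ i
toℕ-mod i = toℕ-injective (≡.trans (toℕ-fromℕ< _) (m<n⇒m%n≡m (toℕ<n i)))

pattern cyc i    = inj₁ i
pattern leaf i j = inj₂ (i , j)

module _ (g d : ℕ) where

  SVertex : Set
  SVertex = Fin g ⊎ (Fin g × Fin (d ℕ.∸ 2))

  SAdj : SVertex → SVertex → Set
  SAdj (cyc i)    (cyc j)    = j ≡ next i ⊎ i ≡ next j
  SAdj (cyc i)    (leaf j _) = i ≡ j
  SAdj (leaf i _) (cyc j)    = i ≡ j
  SAdj (leaf _ _) (leaf _ _) = ⊥

  SAdj? : Decidable SAdj
  SAdj? (cyc i)    (cyc j)    = (j Fin.≟ next i) ⊎-dec (i Fin.≟ next j)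
  SAdj? (cyc i)    (leaf j _) = i Fin.≟ j
  SAdj? (leaf i _) (cyc j)    = i Fin.≟ j
  SAdj? (leaf _ _) (leaf _ _) = no λ ()

  SAdj-sym : Symmetric SAdj
  SAdj-sym {cyc _}    {cyc _}    e = swap e
  SAdj-sym {cyc _}    {leaf _ _} e = ≡.sym e
  SAdj-sym {leaf _ _} {cyc _}    e = ≡.sym e

  SAdj-irrefl : 3 ℕ.≤ g → Irreflexive _≡_ SAdj
  SAdj-irrefl g≥3 {cyc i} ≡.refl (inj₁ e) = next≢ g≥3 i e
  SAdj-irrefl g≥3 {cyc i} ≡.refl (inj₂ e) = next≢ g≥3 i e

  base : 3 ℕ.≤ g → Fin g
  base (s≤s _) = zero

  fromBase : (g≥3 : 3 ℕ.≤ g) → ∀ x → Star SAdj (cyc (base g≥3)) x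
  fromBase g≥3@(s≤s {n = n} _) (leaf i j) = fromBase g≥3 (cyc i) ◅◅ (≡.refl ◅ ε)
  fromBase (s≤s {n = n} _) (cyc i)    =
    subst (λ j → Star SAdj (cyc zero) (cyc j)) (toℕ-mod i) (go (toℕ i))
    where
    go : ∀ k → Star SAdj (cyc zero) (cyc (k mod suc n))
    go zero    = ε
    go (suc k) = go k ◅◅ (inj₁ (≡.sym (mod-next k n)) ◅ ε)

  S : 3 ℕ.≤ g → Graph
  S g≥3 = record
    { V           = SVertex
    ; order       = g ℕ.+ g ℕ.* (d ℕ.∸ 2)
    ; enumeration = (↔-id (Fin g) ⊎-↔ *↔×) ↔-∘ +↔⊎
    ; _≟_         = ⊎-≡-dec Fin._≟_ (×-≡-dec Fin._≟_ Fin._≟_)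
    ; _~_         = SAdj
    ; _~?_        = SAdj?
    ; ~-sym       = λ {x} {y} → SAdj-sym {x} {y}
    ; ~-irrefl    = λ {x} {y} → SAdj-irrefl g≥3 {x} {y}
    ; connected   = λ x y →
        reverse (λ {u} {v} → SAdj-sym {u} {v}) (fromBase g≥3 x) ◅◅ fromBase g≥3 y
    }

module _ {c ℓ₁ ℓ₂} (ℝ : RealNumbers c ℓ₁ ℓ₂) (g d : ℕ) (g≥3 : 3 ℕ.≤ g)
         (w : Weighting ℝ (S g d g≥3)) where
  open RealNumbers ℝ

  cycleEdgeWeight : Fin g → Carrier
  cycleEdgeWeight i = Weighting.weight w (cyc i) (cyc (next i))

  cycleWeight : Carrier
  cycleWeight = sum cycleEdgeWeight

  IsNonGeodesicCycleEdge : Fin g → Set ℓ₂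
  IsNonGeodesicCycleEdge i = 1/ 2 * cycleWeight < cycleEdgeWeight i

{-# OPTIONS --safe #-}

-- Let e = pq be the long edge of the cycle, continued by q, q′, q″ on one side
-- and by p, p′, p″ on the other.  Since e is longer than the rest of the cycle,
-- distances do not use it, and d(q,p) = d(q,q′) + d(q′,p′) + d(p′,p).  Transport
-- plans bound the curvature from below and 1-Lipschitz functions bound it from
-- above.  With N the degree of the cycle vertices, ν = N - 2 the number of leaves
-- at each of them, Λ the total weight of the edges to these leaves and c = 4 - N κ,
-- an Einstein metric satisfies
--
--   c d(q,p)  ≤ d(q,p) + d(q′,p′) + Λ(q) + Λ(p)               (a plan for e)
--   c d(q,q′) ≥ d(q,p) - d(q′,q″) + Λ(q) + Λ(q′)              (a potential for qq′)
--   c d(p,p′) ≥ d(q,p) - d(p′,p″) + Λ(p) + Λ(p′)              (a potential for pp′)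
--   c Λ(q′) ≥ ν (d(q,q′) + d(q′,q″)),  likewise at p′         (the leaf edges).
--
-- Put h = d(q,q′) + d(p,p′), M = d(q′,p′) and r = d(q′,q″) + d(p′,p″).  Eliminating
-- the Λ's gives c² M + c h + ν (h + r) ≤ c r.  This is absurd when r = h, which
-- happens for q′ = p′.  Otherwise r ≤ 2 M, so ((c - 1)² + 2 ν - 1) r + 2 (c + ν) h ≤ 0,
-- which is absurd too.
module Submission where

open import Defs
open import Algebra.Bundles using (CommutativeRing; RawRing)
import Algebra.Properties.AbelianGroup as AbelianGroupProperties
import Algebra.Properties.CommutativeSemigroup as CommutativeSemigroupProperties
import Algebra.Properties.Ring as RingProperties
import Algebra.Properties.Semiring.Mult as Mult
import Algebra.Properties.Semiring.Mult.TCOptimised as MultTC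
import Algebra.Properties.Semiring.Sum as SemiringSum
import Algebra.Solver.Ring as RingSolver
open import Algebra.Solver.Ring.AlmostCommutativeRing
  using (fromCommutativeRing; _-Raw-AlmostCommutative⟶_)
open import Data.Empty using (⊥)
open import Data.Fin.Base as Fin using (Fin; zero; suc; toℕ)
open import Data.Fin.Permutation using (Permutation; permutation)
import Data.Fin.Properties as Fin
open import Data.List.Base using (filter; length; tabulate)
open import Data.Maybe.Base using (Maybe; just; nothing)
open import Data.Nat.Base as ℕ using (ℕ; zero; suc)
open import Data.Nat.DivMod
  using (_mod_; _%_; _/_; m<n⇒m%n≡m; %-distribˡ-+; m%n%n≡m%n; [m+n]%n≡m%n; m≡m%n+[m/n]*n)
import Data.Nat.Properties as ℕ
open import Data.Product using (∃-syntax; _×_; _,_; proj₁; proj₂)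
open import Data.Sum using (_⊎_; inj₁; inj₂; [_,_]′; swap)
open import Data.Unit.Base using (⊤; tt)
open import Data.Vec.Functional using (removeAt)
open import Function.Base using (id)
open import Function.Bundles using (Inverse)
open import Relation.Binary.Construct.Closure.ReflexiveTransitive using (ε; _◅_; _◅◅_)
open import Relation.Binary.PropositionalEquality as ≡ using (_≡_; _≢_)
open import Relation.Nullary using (¬_; Dec; yes; no; contradiction)
open import Relation.Nullary.Decidable using (_×-dec_)

module IntegerSolver {c ℓ} (R : CommutativeRing c ℓ) where
  open CommutativeRing R
  open RingProperties ring using (x[y-z]≈xy-xz; [y-z]x≈yx-zx)
  open AbelianGroupProperties +-abelianGroup using ()
    renaming (⁻¹-∙-comm to -‿+-comm; ⁻¹-anti-homo‿- to -‿anti-homo‿-)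
  open CommutativeSemigroupProperties +-commutativeSemigroup using (interchange)
  open Mult semiring using (×-homo-+; ×1-homo-*) renaming (_×_ to _·_)
  open MultTC semiring using (×ᵤ≈×) renaming (_×_ to _·′_)
  open import Relation.Binary.Reasoning.Setoid setoid

  -- The pair (m , n) stands for the integer m - n; pairs are kept reduced
  -- because the solver compares normal forms syntactically.
  reduced : ℕ → ℕ → ℕ × ℕ
  reduced m n = m ℕ.∸ n , n ℕ.∸ m

  differences : RawRing _ _
  differences = record
    { Carrier = ℕ × ℕ
    ; _≈_     = _≡_
    ; _+_     = λ (m , n) (m′ , n′) → reduced (m ℕ.+ m′) (n ℕ.+ n′)
    ; _*_     = λ (m , n) (m′ , n′) → reduced (m ℕ.* m′ ℕ.+ n ℕ.* n′) (m ℕ.* n′ ℕ.+ n ℕ.* m′)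
    ; -_      = λ (m , n) → n , m
    ; 0#      = 0 , 0
    ; 1#      = 1 , 0
    }

  -- The clause for n = 0 makes the numerals 0 and 1 evaluate to 0# and 1#.
  ⟦_⟧ : ℕ × ℕ → Carrier
  ⟦ m , zero  ⟧ = m ·′ 1#
  ⟦ m , suc n ⟧ = m · 1# - suc n · 1#

  ⟦⟧≈ : ∀ m n → ⟦ m , n ⟧ ≈ m · 1# - n · 1#
  ⟦⟧≈ m (suc n) = refl
  ⟦⟧≈ m zero    = begin
    m ·′ 1#       ≈⟨ ×ᵤ≈× m 1# ⟨
    m · 1#        ≈⟨ +-identityʳ _ ⟨
    m · 1# + 0#   ≈⟨ +-congˡ (trans (sym (-‿inverseʳ 0#)) (+-identityˡ _)) ⟩
    m · 1# - 0#   ∎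

  sub-interchange : ∀ x y x′ y′ → (x + x′) - (y + y′) ≈ (x - y) + (x′ - y′)
  sub-interchange x y x′ y′ =
    trans (+-congˡ (sym (-‿+-comm y y′))) (interchange x x′ (- y) (- y′))

  *-expand : ∀ x y x′ y′ → (x - y) * (x′ - y′) ≈ (x * x′ + y * y′) - (x * y′ + y * x′)
  *-expand x y x′ y′ = begin
    (x - y) * (x′ - y′)                         ≈⟨ x[y-z]≈xy-xz _ x′ y′ ⟩
    (x - y) * x′ - (x - y) * y′                 ≈⟨ +-cong ([y-z]x≈yx-zx x′ x y) (-‿cong ([y-z]x≈yx-zx y′ x y)) ⟩
    (x * x′ - y * x′) - (x * y′ - y * y′)       ≈⟨ +-congˡ (-‿anti-homo‿- (x * y′) (y * y′)) ⟩
    (x * x′ - y * x′) + (y * y′ - x * y′)       ≈⟨ sub-interchange _ _ _ _ ⟨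
    (x * x′ + y * y′) - (y * x′ + x * y′)       ≈⟨ +-congˡ (-‿cong (+-comm _ _)) ⟩
    (x * x′ + y * y′) - (x * y′ + y * x′)       ∎

  cross-sum : ∀ {x y x′ y′} → x + y′ ≈ x′ + y → x - y ≈ x′ - y′
  cross-sum {x} {y} {x′} {y′} eq = begin
    x - y                       ≈⟨ +-identityʳ _ ⟨
    (x - y) + 0#                ≈⟨ +-congˡ (-‿inverseʳ y′) ⟨
    (x - y) + (y′ - y′)         ≈⟨ sub-interchange _ _ _ _ ⟨
    (x + y′) - (y + y′)         ≈⟨ +-cong eq (-‿cong (+-comm y y′)) ⟩
    (x′ + y) - (y′ + y)         ≈⟨ sub-interchange _ _ _ _ ⟩
    (x′ - y′) + (y - y)         ≈⟨ +-congˡ (-‿inverseʳ y) ⟩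
    (x′ - y′) + 0#              ≈⟨ +-identityʳ _ ⟩
    x′ - y′                     ∎

  ∸-cross : ∀ m n → m ℕ.∸ n ℕ.+ n ≡ m ℕ.+ (n ℕ.∸ m)
  ∸-cross zero    zero    = ≡.refl
  ∸-cross zero    (suc n) = ≡.refl
  ∸-cross (suc m) zero    = ≡.refl
  ∸-cross (suc m) (suc n) = ≡.trans (ℕ.+-suc (m ℕ.∸ n) n) (≡.cong suc (∸-cross m n))

  ·-cross : ∀ m n m′ n′ → m ℕ.+ n′ ≡ m′ ℕ.+ n → m · 1# - n · 1# ≈ m′ · 1# - n′ · 1#
  ·-cross m n m′ n′ eq = cross-sum (trans (sym (×-homo-+ 1# m n′))
    (trans (reflexive (≡.cong (_· 1#) eq)) (×-homo-+ 1# m′ n)))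

  ⟦reduced⟧≈ : ∀ m n → ⟦ reduced m n ⟧ ≈ m · 1# - n · 1#
  ⟦reduced⟧≈ m n = trans (⟦⟧≈ (m ℕ.∸ n) (n ℕ.∸ m))
    (·-cross (m ℕ.∸ n) (n ℕ.∸ m) m n (∸-cross m n))

  differences⟶R : differences -Raw-AlmostCommutative⟶ fromCommutativeRing R
  differences⟶R = record
    { ⟦_⟧    = ⟦_⟧
    ; +-homo = λ (m , n) (m′ , n′) → begin
        ⟦ reduced (m ℕ.+ m′) (n ℕ.+ n′) ⟧                ≈⟨ ⟦reduced⟧≈ (m ℕ.+ m′) (n ℕ.+ n′) ⟩
        (m ℕ.+ m′) · 1# - (n ℕ.+ n′) · 1#                ≈⟨ +-cong (×-homo-+ 1# m m′) (-‿cong (×-homo-+ 1# n n′)) ⟩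
        (m · 1# + m′ · 1#) - (n · 1# + n′ · 1#)          ≈⟨ sub-interchange _ _ _ _ ⟩
        (m · 1# - n · 1#) + (m′ · 1# - n′ · 1#)          ≈⟨ +-cong (⟦⟧≈ m n) (⟦⟧≈ m′ n′) ⟨
        ⟦ m , n ⟧ + ⟦ m′ , n′ ⟧                          ∎
    ; *-homo = λ (m , n) (m′ , n′) → begin
        ⟦ reduced (m ℕ.* m′ ℕ.+ n ℕ.* n′) (m ℕ.* n′ ℕ.+ n ℕ.* m′) ⟧
          ≈⟨ ⟦reduced⟧≈ (m ℕ.* m′ ℕ.+ n ℕ.* n′) (m ℕ.* n′ ℕ.+ n ℕ.* m′) ⟩
        (m ℕ.* m′ ℕ.+ n ℕ.* n′) · 1# - (m ℕ.* n′ ℕ.+ n ℕ.* m′) · 1#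
          ≈⟨ +-cong (·-homo m m′ n n′) (-‿cong (·-homo m n′ n m′)) ⟩
        (m · 1# * m′ · 1# + n · 1# * n′ · 1#) - (m · 1# * n′ · 1# + n · 1# * m′ · 1#)
          ≈⟨ *-expand _ _ _ _ ⟨
        (m · 1# - n · 1#) * (m′ · 1# - n′ · 1#)          ≈⟨ *-cong (⟦⟧≈ m n) (⟦⟧≈ m′ n′) ⟨
        ⟦ m , n ⟧ * ⟦ m′ , n′ ⟧                          ∎
    ; -‿homo = λ (m , n) → begin
        ⟦ n , m ⟧               ≈⟨ ⟦⟧≈ n m ⟩
        n · 1# - m · 1#         ≈⟨ -‿anti-homo‿- (m · 1#) (n · 1#) ⟨
        - (m · 1# - n · 1#)     ≈⟨ -‿cong (⟦⟧≈ m n) ⟨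
        - ⟦ m , n ⟧             ∎
    ; 0-homo = refl
    ; 1-homo = refl
    }
    where
    ·-homo : ∀ m m′ n n′ →
      (m ℕ.* m′ ℕ.+ n ℕ.* n′) · 1# ≈ m · 1# * m′ · 1# + n · 1# * n′ · 1#
    ·-homo m m′ n n′ = trans (×-homo-+ 1# (m ℕ.* m′) (n ℕ.* n′))
                             (+-cong (×1-homo-* m m′) (×1-homo-* n n′))

  _coeff≟_ : ∀ i j → Maybe (⟦ i ⟧ ≈ ⟦ j ⟧)
  (m , n) coeff≟ (m′ , n′) with m ℕ.+ n′ ℕ.≟ m′ ℕ.+ n
  ... | no  _  = nothing
  ... | yes eq = just (begin
    ⟦ m , n ⟧            ≈⟨ ⟦⟧≈ m n ⟩
    m · 1# - n · 1#      ≈⟨ ·-cross m n m′ n′ eq ⟩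
    m′ · 1# - n′ · 1#    ≈⟨ ⟦⟧≈ m′ n′ ⟨
    ⟦ m′ , n′ ⟧          ∎)

  open RingSolver differences (fromCommutativeRing R) differences⟶R _coeff≟_ public
    using (Polynomial; solve; _:=_; _:+_; _:*_; _:-_; :-_; con)

  :0 :1 : ∀ {n} → Polynomial n
  :0 = con (0 , 0)
  :1 = con (1 , 0)

module OrderedField {c ℓ₁ ℓ₂} (ℝ : RealNumbers c ℓ₁ ℓ₂) where
  open RealNumbers ℝ hiding (zero) public
  open CommutativeRing commutativeRing public using (semiring)
  open IntegerSolver commutativeRing public
    using (solve; _:=_; _:+_; _:*_; _:-_; :-_; :0; :1)
  open SemiringSum semiring public
    using (sum-cong-≋; sum-remove; ∑-distrib-+; ∑-comm; *-distribˡ-sum; *-distribʳ-sum;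
           sum-replicate; sum-replicate-zero; sum-permute)
  open Mult semiring using (×-assoc-*; ×-congʳ)

  <-irreflexive : ∀ {x} → ¬ (x < x)
  <-irreflexive = <-irrefl refl

  <-cotrans : ∀ {x y} → x < y → ∀ z → x < z ⊎ z < y
  <-cotrans x<y z with #-cotrans (<⇒# x<y) z
  ... | inj₁ x#z with #⇒<⊎> x#z
  ...   | inj₁ x<z = inj₁ x<z
  ...   | inj₂ z<x = inj₂ (<-trans z<x x<y)
  <-cotrans x<y z | inj₂ z#y with #⇒<⊎> z#y
  ...   | inj₁ z<y = inj₂ z<y
  ...   | inj₂ y<z = inj₁ (<-trans x<y y<z)

  0≤0 : 0# ≤ 0#
  0≤0 = <-irreflexive

  0≤1 : 0# ≤ 1#
  0≤1 1<0 = <-irreflexive (<-trans 0<1 1<0)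

  pos⇒0≤ : ∀ {x} → 0# < x → 0# ≤ x
  pos⇒0≤ 0<x x<0 = <-irreflexive (<-trans 0<x x<0)

  0≤-resp-≈ : ∀ {x y} → x ≈ y → 0# ≤ x → 0# ≤ y
  0≤-resp-≈ x≈y 0≤x y<0 = 0≤x (<-respˡ-≈ (sym x≈y) y<0)

  ≤⇒0≤- : ∀ {x y} → x ≤ y → 0# ≤ y - x
  ≤⇒0≤- {x} {y} x≤y y-x<0 = x≤y
    (<-respˡ-≈ (solve 2 (λ x y → y :- x :+ x := y) refl x y)
      (<-respʳ-≈ (+-identityˡ x) (+-monoˡ-< x y-x<0)))

  0≤-⇒≤ : ∀ {x y} → 0# ≤ y - x → x ≤ y
  0≤-⇒≤ {x} 0≤y-x y<x = 0≤y-x (<-respʳ-≈ (-‿inverseʳ x) (+-monoˡ-< (- x) y<x))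

  0<-⇒< : ∀ {x y} → 0# < y - x → x < y
  0<-⇒< {x} {y} 0<y-x = <-respˡ-≈ (+-identityˡ x)
    (<-respʳ-≈ (solve 2 (λ x y → y :- x :+ x := y) refl x y) (+-monoˡ-< x 0<y-x))

  neg⇒0<- : ∀ {x} → x < 0# → 0# < - x
  neg⇒0<- {x} x<0 = <-respʳ-≈ (+-identityˡ (- x)) (x<y⇒0<y-x x<0)

  +-pos-0≤ : ∀ {x y} → 0# < x → 0# ≤ y → 0# < x + y
  +-pos-0≤ {x} {y} 0<x 0≤y with <-cotrans (<-respˡ-≈ (+-identityˡ y) (+-monoˡ-< y 0<x)) 0#
  ... | inj₁ y<0   = contradiction y<0 0≤y
  ... | inj₂ 0<x+y = 0<x+y

  0≤-+ : ∀ {x y} → 0# ≤ x → 0# ≤ y → 0# ≤ x + y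
  0≤-+ {x} {y} 0≤x 0≤y x+y<0 with <-cotrans x+y<0 x
  ... | inj₂ x<0   = 0≤x x<0
  ... | inj₁ x+y<x = 0≤y (<-respˡ-≈ (solve 2 (λ x y → x :+ y :- x := y) refl x y)
                       (<-respʳ-≈ (-‿inverseʳ x) (+-monoˡ-< (- x) x+y<x)))

  ¬¬0≤⇒0<⊎≈0 : ∀ {x} → 0# ≤ x → ¬ ¬ (0# < x ⊎ x ≈ 0#)
  ¬¬0≤⇒0<⊎≈0 {x} 0≤x no-case = no-case (inj₂ (proj₁ (tight x 0#) λ x#0 →
    [ 0≤x , (λ 0<x → no-case (inj₁ 0<x)) ]′ (#⇒<⊎> x#0)))

  0≤-* : ∀ {x y} → 0# ≤ x → 0# ≤ y → 0# ≤ x * y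
  0≤-* {x} {y} 0≤x 0≤y xy<0 = ¬¬0≤⇒0<⊎≈0 0≤x λ
    { (inj₂ x≈0) → <-irrefl (trans (*-congʳ x≈0) (zeroˡ y)) xy<0
    ; (inj₁ 0<x) → ¬¬0≤⇒0<⊎≈0 0≤y λ
      { (inj₂ y≈0) → <-irrefl (trans (*-congˡ y≈0) (zeroʳ x)) xy<0
      ; (inj₁ 0<y) → pos⇒0≤ (*-pos 0<x 0<y) xy<0
      } }

  0≤-square : ∀ x → 0# ≤ x * x
  0≤-square x xx<0 = 0≤x λ x<0 → pos⇒0≤ (*-pos (neg⇒0<- x<0) (neg⇒0<- x<0))
      (<-respˡ-≈ (solve 1 (λ x → x :* x := (:- x) :* (:- x)) refl x) xx<0)
    where
    0≤x : 0# ≤ x → ⊥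
    0≤x 0≤x = 0≤-* 0≤x 0≤x xx<0

  ≈0-of-0≤ : ∀ {x} → 0# ≤ x → 0# ≤ - x → x ≈ 0#
  ≈0-of-0≤ {x} 0≤x 0≤-x = proj₁ (tight x 0#) λ x#0 → [ 0≤x , (λ 0<x → 0≤-x
    (<-respˡ-≈ (+-identityˡ (- x)) (<-respʳ-≈ (-‿inverseʳ x) (+-monoˡ-< (- x) 0<x)))) ]′ (#⇒<⊎> x#0)

  -- Every contradiction below is reached by exhibiting such a pair.
  pos+0≤≉0 : ∀ {x y} → 0# < x → 0# ≤ y → ¬ (x + y ≈ 0#)
  pos+0≤≉0 0<x 0≤y x+y≈0 = <-irrefl (sym x+y≈0) (+-pos-0≤ 0<x 0≤y)

  *-cancelˡ-0< : ∀ {a x} → 0# < a → 0# < a * x → 0# < x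
  *-cancelˡ-0< {a} {x} 0<a 0<ax with #⇒<⊎> x#0
    where
    x#0 : x # 0#
    x#0 with a⁻¹ , inv , inv′ ← #⇒invertible (#-sym (<⇒# 0<ax)) =
      invertible⇒# (a * a⁻¹ , trans (eq a⁻¹) inv , trans (eq′ a⁻¹) inv′)
      where
      eq : ∀ b → a * b * (x - 0#) ≈ b * (a * x - 0#)
      eq b = solve 3 (λ a x b → a :* b :* (x :- :0) := b :* (a :* x :- :0)) refl a x b
      eq′ : ∀ b → (x - 0#) * (a * b) ≈ (a * x - 0#) * b
      eq′ b = solve 3 (λ a x b → (x :- :0) :* (a :* b) := (a :* x :- :0) :* b) refl a x b
  ... | inj₂ 0<x = 0<x
  ... | inj₁ x<0 = contradiction
    (solve 2 (λ a x → a :* (:- x) :+ a :* x := :0) refl a x)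
    (pos+0≤≉0 (*-pos 0<a (neg⇒0<- x<0)) (pos⇒0≤ 0<ax))

  inverse-inverseʳ : ∀ x (0<x : 0# < x) → x * inverse x 0<x ≈ 1#
  inverse-inverseʳ x 0<x with #⇒invertible (#-sym (<⇒# 0<x))
  ... | x⁻¹ , _ , inv = trans (solve 2 (λ x y → x :* y := (x :- :0) :* y) refl x x⁻¹) inv

  inverse-pos : ∀ x (0<x : 0# < x) → 0# < inverse x 0<x
  inverse-pos x 0<x = *-cancelˡ-0< 0<x (<-respʳ-≈ (sym (inverse-inverseʳ x 0<x)) 0<1)

  -- As 1/2 * b < b, either 1/2 * b < a or a < b.
  common-lower-bound : ∀ {a b} → 0# < a → 0# < b → ∃[ ε ] 0# < ε × ε < a × ε < b
  common-lower-bound {a} {b} 0<a 0<b = choose (<-cotrans (half< 0<b) a)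
    where
    half : Carrier
    half = inverse (1# + 1#) (x+y-pos 0<1 0<1)

    half-pos : ∀ {x} → 0# < x → 0# < half * x
    half-pos = *-pos (inverse-pos (1# + 1#) (x+y-pos 0<1 0<1))

    x≈half+half : ∀ x → half * x ≈ x - half * x
    x≈half+half x = trans (solve 2 (λ x h → h :* x := (:1 :+ :1) :* h :* x :- h :* x) refl x half)
      (+-congʳ (trans (*-congʳ (inverse-inverseʳ (1# + 1#) (x+y-pos 0<1 0<1))) (*-identityˡ x)))

    half< : ∀ {x} → 0# < x → half * x < x
    half< {x} 0<x = 0<-⇒< (<-respʳ-≈ (x≈half+half x) (half-pos 0<x))

    choose : half * b < a ⊎ a < b → ∃[ ε ] 0# < ε × ε < a × ε < b
    choose (inj₁ b/2<a) = half * b , half-pos 0<b , b/2<a , half< 0<b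
    choose (inj₂ a<b)   = half * a , half-pos 0<a , half< 0<a , <-trans (half< 0<a) a<b

  fromℕ-0≤ : ∀ n → 0# ≤ fromℕ n
  fromℕ-0≤ zero    = 0≤0
  fromℕ-0≤ (suc n) = pos⇒0≤ (0<fromℕ n)

  1/-inverse : ∀ n → fromℕ (suc n) * 1/ (suc n) ≈ 1#
  1/-inverse n = inverse-inverseʳ (fromℕ (suc n)) (0<fromℕ n)

  sum-0≤ : ∀ {n} (t : Fin n → Carrier) → (∀ i → 0# ≤ t i) → 0# ≤ sum t
  sum-0≤ {zero}  t 0≤t = 0≤0
  sum-0≤ {suc n} t 0≤t = 0≤-+ (0≤t zero) (sum-0≤ (λ i → t (suc i)) λ i → 0≤t (suc i))

  sum-zero : ∀ {n} (t : Fin n → Carrier) → (∀ i → t i ≈ 0#) → sum t ≈ 0#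
  sum-zero {n} t t≈0 = trans (sum-cong-≋ t≈0) (sum-replicate-zero n)

  sum-single : ∀ {n} (t : Fin n → Carrier) i → (∀ j → j ≢ i → t j ≈ 0#) → sum t ≈ t i
  sum-single {suc n} t i off = trans (sum-remove t)
    (trans (+-congˡ (sum-zero _ λ j → off _ (Fin.punchInᵢ≢i i j))) (+-identityʳ (t i)))

  term≤sum : ∀ {n} (t : Fin n → Carrier) → (∀ i → 0# ≤ t i) → ∀ i → 0# ≤ sum t - t i
  term≤sum {suc n} t 0≤t i = 0≤-resp-≈
    (sym (trans (+-congʳ (sum-remove t)) (solve 2 (λ x y → x :+ y :- x := y) refl (t i) _)))
    (sum-0≤ (removeAt t i) λ j → 0≤t (Fin.punchIn i j))

  sum-const : ∀ n x → sum {n} (λ _ → x) ≈ fromℕ n * x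
  sum-const n x = trans (sum-replicate n)
    (sym (trans (×-assoc-* n 1# x) (×-congʳ n (*-identityˡ x))))

  sum-neg : ∀ {n} (t : Fin n → Carrier) → sum (λ i → - t i) ≈ - sum t
  sum-neg {zero}  t = solve 0 (:0 := :- :0) refl
  sum-neg {suc n} t = trans (+-congˡ (sum-neg λ i → t (suc i)))
    (solve 2 (λ x y → :- x :+ :- y := :- (x :+ y)) refl (t zero) _)

  ∑-distrib-- : ∀ {n} (s t : Fin n → Carrier) → sum (λ i → s i - t i) ≈ sum s - sum t
  ∑-distrib-- s t = trans (∑-distrib-+ s (λ i → - t i)) (+-congˡ (sum-neg t))

module Transport {c ℓ₁ ℓ₂} (ℝ : RealNumbers c ℓ₁ ℓ₂) (G : Graph) where
  open OrderedField ℝ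
  open Graph G

  indicator : ∀ {P : Set} → Dec P → Carrier
  indicator (yes _) = 1#
  indicator (no _)  = 0#

  indicator-true : ∀ {P : Set} (P? : Dec P) → P → indicator P? ≈ 1#
  indicator-true (yes _) p = refl
  indicator-true (no ¬p) p = contradiction p ¬p

  indicator-false : ∀ {P : Set} (P? : Dec P) → ¬ P → indicator P? ≈ 0#
  indicator-false (yes p) ¬p = contradiction p ¬p
  indicator-false (no _)  ¬p = refl

  indicator-0≤ : ∀ {P : Set} (P? : Dec P) → 0# ≤ indicator P?
  indicator-0≤ (yes _) = 0≤1
  indicator-0≤ (no _)  = 0≤0

  δ : V → V → Carrier
  δ a z = indicator (a ≟ z)

  ∑ᵥ-cong : ∀ {f h : V → Carrier} → (∀ z → f z ≈ h z) → ∑ᵥ ℝ G f ≈ ∑ᵥ ℝ G h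
  ∑ᵥ-cong f≈h = sum-cong-≋ λ i → f≈h (vertex i)

  ∑ᵥ-distrib-+ : ∀ (f h : V → Carrier) → ∑ᵥ ℝ G (λ z → f z + h z) ≈ ∑ᵥ ℝ G f + ∑ᵥ ℝ G h
  ∑ᵥ-distrib-+ f h = ∑-distrib-+ (λ i → f (vertex i)) (λ i → h (vertex i))

  ∑ᵥ-distrib-- : ∀ (f h : V → Carrier) → ∑ᵥ ℝ G (λ z → f z - h z) ≈ ∑ᵥ ℝ G f - ∑ᵥ ℝ G h
  ∑ᵥ-distrib-- f h = ∑-distrib-- (λ i → f (vertex i)) (λ i → h (vertex i))

  ∑ᵥ-*ˡ : ∀ a (f : V → Carrier) → ∑ᵥ ℝ G (λ z → a * f z) ≈ a * ∑ᵥ ℝ G f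
  ∑ᵥ-*ˡ a f = sym (*-distribˡ-sum a (λ i → f (vertex i)))

  ∑ᵥ-sum-comm : ∀ {k} (h : V → Fin k → Carrier) →
    ∑ᵥ ℝ G (λ z → sum (h z)) ≈ sum (λ i → ∑ᵥ ℝ G (λ z → h z i))
  ∑ᵥ-sum-comm h = ∑-comm (λ j i → h (vertex j) i)

  ∑ᵥ-0≤ : ∀ (f : V → Carrier) → (∀ z → 0# ≤ f z) → 0# ≤ ∑ᵥ ℝ G f
  ∑ᵥ-0≤ f 0≤f = sum-0≤ (λ i → f (vertex i)) λ i → 0≤f (vertex i)

  ∑ᵥ-δ : ∀ (f : V → Carrier) a → ∑ᵥ ℝ G (λ z → f z * δ a z) ≈ f a
  ∑ᵥ-δ f a = begin
    ∑ᵥ ℝ G (λ z → f z * δ a z)      ≈⟨ sum-single _ i (λ j j≢i → trans (*-congˡ (indicator-false (a ≟ vertex j) (off j j≢i))) (zeroʳ _)) ⟩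
    f (vertex i) * δ a (vertex i)   ≡⟨ ≡.cong (λ z → f z * δ a z) vertex-i ⟩
    f a * δ a a                     ≈⟨ *-congˡ (indicator-true (a ≟ a) ≡.refl) ⟩
    f a * 1#                        ≈⟨ *-identityʳ (f a) ⟩
    f a                             ∎
    where
    open import Relation.Binary.Reasoning.Setoid setoid
    i = Inverse.from enumeration a
    vertex-i : vertex i ≡ a
    vertex-i = Inverse.strictlyInverseˡ enumeration a
    off : ∀ j → j ≢ i → a ≢ vertex j
    off j j≢i a≡ = j≢i (≡.trans (≡.sym (Inverse.strictlyInverseʳ enumeration j))
                                (≡.cong (Inverse.from enumeration) (≡.sym a≡)))

  ∑ᵥ-δ-one : ∀ a → ∑ᵥ ℝ G (δ a) ≈ 1#
  ∑ᵥ-δ-one a = trans (∑ᵥ-cong λ z → sym (*-identityˡ (δ a z))) (∑ᵥ-δ (λ _ → 1#) a)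

  record Enumerates {k} (x : V) (b : Fin k → V) : Set where
    field
      injective  : ∀ i j → b i ≡ b j → i ≡ j
      adjacent   : ∀ i → x ~ b i
      exhaustive : ∀ z → x ~ z → ∃[ i ] b i ≡ z

  length-filter : ∀ {n} {A : Set} {P : A → Set} (P? : ∀ a → Dec (P a)) (h : Fin n → A) →
    fromℕ (length (filter P? (tabulate h))) ≈ sum (λ i → indicator (P? (h i)))
  length-filter {zero}  P? h = refl
  length-filter {suc n} P? h with P? (h zero)
  ... | yes _ = +-congˡ (length-filter P? λ i → h (suc i))
  ... | no _  = trans (length-filter P? λ i → h (suc i)) (sym (+-identityˡ _))

  module _ {k} {x : V} {b : Fin k → V} (E : Enumerates x b) where
    open Enumerates E

    adjacency-sum : ∀ z → indicator (x ~? z) ≈ sum (λ i → δ (b i) z)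
    adjacency-sum z with x ~? z
    ... | no x≁z  = sym (sum-zero _ λ i → indicator-false (b i ≟ z) λ bi≡z →
                      x≁z (≡.subst (x ~_) bi≡z (adjacent i)))
    ... | yes x~z with i , ≡.refl ← exhaustive z x~z = sym (trans
      (sum-single _ i λ j j≢i → indicator-false (b j ≟ b i) λ eq → j≢i (injective j i eq))
      (indicator-true (b i ≟ b i) ≡.refl))

    fromℕ-degree : fromℕ (degree x) ≈ fromℕ k
    fromℕ-degree = begin
      fromℕ (degree x)                               ≈⟨ length-filter (x ~?_) vertex ⟩
      ∑ᵥ ℝ G (λ z → indicator (x ~? z))              ≈⟨ ∑ᵥ-cong adjacency-sum ⟩
      ∑ᵥ ℝ G (λ z → sum (λ i → δ (b i) z))           ≈⟨ ∑ᵥ-sum-comm (λ z i → δ (b i) z) ⟩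
      sum (λ i → ∑ᵥ ℝ G (δ (b i)))                   ≈⟨ sum-cong-≋ (λ i → ∑ᵥ-δ-one (b i)) ⟩
      sum {k} (λ _ → 1#)                             ≈⟨ sum-replicate k ⟩
      fromℕ k                                        ∎
      where open import Relation.Binary.Reasoning.Setoid setoid

    μ-expand : ∀ α z → μ ℝ G α x z ≈
      α * δ x z + (1# - α) * 1/ degree x * sum (λ i → δ (b i) z)
    μ-expand α z = trans (by-cases z) (+-congˡ (*-congˡ (adjacency-sum z)))
      where
      by-cases : ∀ z → μ ℝ G α x z ≈ α * δ x z + (1# - α) * 1/ degree x * indicator (x ~? z)
      by-cases z with x ≟ z | x ~? z
      ... | yes x≡z | yes x~z = contradiction x≡z (~⇒≢ x~z)
      ... | yes _   | no _    = solve 2 (λ a b → a := a :* :1 :+ b :* :0) refl α _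
      ... | no _    | yes _   = solve 2 (λ a b → b := a :* :0 :+ b :* :1) refl α _
      ... | no _    | no _    = solve 2 (λ a b → :0 := a :* :0 :+ b :* :0) refl α _

    ∑ᵥ-μ : ∀ (f : V → Carrier) α → ∑ᵥ ℝ G (λ z → f z * μ ℝ G α x z) ≈
      α * f x + (1# - α) * 1/ degree x * sum (λ i → f (b i))
    ∑ᵥ-μ f α = begin
      ∑ᵥ ℝ G (λ z → f z * μ ℝ G α x z)
        ≈⟨ ∑ᵥ-cong (λ z → trans (*-congˡ (μ-expand α z))
             (solve 5 (λ f a d e s → f :* (a :* d :+ e :* s) := a :* (f :* d) :+ e :* (f :* s))
               refl (f z) α (δ x z) e (sum λ i → δ (b i) z))) ⟩
      ∑ᵥ ℝ G (λ z → α * (f z * δ x z) + e * (f z * sum (λ i → δ (b i) z)))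
        ≈⟨ ∑ᵥ-distrib-+ (λ z → α * (f z * δ x z)) (λ z → e * (f z * sum (λ i → δ (b i) z))) ⟩
      ∑ᵥ ℝ G (λ z → α * (f z * δ x z)) + ∑ᵥ ℝ G (λ z → e * (f z * sum (λ i → δ (b i) z)))
        ≈⟨ +-cong (∑ᵥ-*ˡ α (λ z → f z * δ x z)) (∑ᵥ-*ˡ e (λ z → f z * sum (λ i → δ (b i) z))) ⟩
      α * ∑ᵥ ℝ G (λ z → f z * δ x z) + e * ∑ᵥ ℝ G (λ z → f z * sum (λ i → δ (b i) z))
        ≈⟨ +-cong (*-congˡ (∑ᵥ-δ f x)) (*-congˡ (trans
             (∑ᵥ-cong λ z → *-distribˡ-sum (f z) (λ i → δ (b i) z))
             (trans (∑ᵥ-sum-comm λ z i → f z * δ (b i) z)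
               (sum-cong-≋ λ i → ∑ᵥ-δ f (b i))))) ⟩
      α * f x + e * sum (λ i → f (b i)) ∎
      where
      open import Relation.Binary.Reasoning.Setoid setoid
      e = (1# - α) * 1/ degree x

  1/degree-inverse : ∀ {k} {x : V} {b : Fin (suc k) → V} → Enumerates x b →
    fromℕ (suc k) * 1/ degree x ≈ 1#
  1/degree-inverse {k} {x} E with degree x | fromℕ-degree E
  ... | zero  | 0≈k = contradiction (0<fromℕ k) (<-irrefl 0≈k)
  ... | suc m | m≈k = trans (*-congʳ (sym m≈k)) (1/-inverse m)

  module _ {w : Weighting ℝ G} (D : Distance ℝ G w) where
    open Weighting w
    open Distance D

    Lipschitz : (V → Carrier) → Set ℓ₂
    Lipschitz f = ∀ u v → 0# ≤ dist u v - (f u - f v)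

    walkWeight-0≤ : ∀ {u v} (p : Walk u v) → 0# ≤ walkWeight p
    walkWeight-0≤ ε       = 0≤0
    walkWeight-0≤ (e ◅ p) = 0≤-+ (pos⇒0≤ (weight-pos e)) (walkWeight-0≤ p)

    dist-0≤ : ∀ u v → 0# ≤ dist u v
    dist-0≤ u v with p , eq ← attained u v = 0≤-resp-≈ eq (walkWeight-0≤ p)

    dist-refl : ∀ u → dist u u ≈ 0#
    dist-refl u = ≈0-of-0≤ (dist-0≤ u u) (0≤-resp-≈ (+-identityˡ _) (≤⇒0≤- (minimal (ε {x = u}))))

    edgewise⇒Lipschitz : ∀ f → (∀ {u v} → u ~ v → 0# ≤ weight u v - (f u - f v)) → Lipschitz f
    edgewise⇒Lipschitz f edge u v with p , eq ← attained u v =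
      0≤-resp-≈ (+-congʳ eq) (along p)
      where
      along : ∀ {u v} (p : Walk u v) → 0# ≤ walkWeight p - (f u - f v)
      along {u} ε = 0≤-resp-≈ (solve 1 (λ a → :0 := :0 :- (a :- a)) refl (f u)) 0≤0
      along {u} {v} (_◅_ {_} {z} e p) = 0≤-resp-≈
        (solve 5 (λ x y a b c → (x :- (a :- b)) :+ (y :- (b :- c)) := x :+ y :- (a :- c))
          refl (weight u z) (walkWeight p) (f u) (f z) (f v))
        (0≤-+ (edge e) (along p))

    dist-step : ∀ {u v} y → u ~ v → 0# ≤ dist y v + weight u v - dist y u
    dist-step {u} {v} y u~v with p , eq ← attained y v = 0≤-resp-≈
      (+-congʳ (trans (walkWeight-snoc p) (+-cong eq (sym (weight-sym u~v)))))
      (≤⇒0≤- (minimal (p ◅◅ (~-sym u~v ◅ ε))))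
      where
      walkWeight-snoc : ∀ {a} (p : Walk a v) →
        walkWeight (p ◅◅ (~-sym u~v ◅ ε)) ≈ walkWeight p + weight v u
      walkWeight-snoc ε       = trans (+-identityʳ _) (sym (+-identityˡ _))
      walkWeight-snoc (e ◅ p) = trans (+-congˡ (walkWeight-snoc p)) (sym (+-assoc _ _ _))

    dist-Lipschitz : ∀ y → Lipschitz (dist y)
    dist-Lipschitz y = edgewise⇒Lipschitz (dist y) λ {u} {v} u~v → 0≤-resp-≈
      (solve 3 (λ a b c → a :+ b :- c := b :- (c :- a)) refl (dist y v) (weight u v) (dist y u))
      (dist-step y u~v)

    dist-sym : ∀ u v → dist u v ≈ dist v u
    dist-sym u v = trans (solve 2 (λ a b → a := a :- b :+ b) refl (dist u v) (dist v u))
      (trans (+-congʳ (≈0-of-0≤ (half v u) (0≤-resp-≈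
        (solve 2 (λ a b → b :- a := :- (a :- b)) refl (dist u v) (dist v u)) (half u v))))
        (+-identityˡ _))
      where
      half : ∀ u v → 0# ≤ dist v u - dist u v
      half u v = 0≤-resp-≈
        (trans (+-congˡ (-‿cong (+-congˡ (-‿cong (dist-refl u)))))
          (solve 2 (λ a b → b :- (a :- :0) := b :- a) refl (dist u v) (dist v u)))
        (dist-Lipschitz u v u)

    dist-triangle : ∀ x y z → 0# ≤ dist x y + dist y z - dist x z
    dist-triangle x y z = 0≤-resp-≈
      (trans (+-congʳ (dist-sym z y))
        (solve 3 (λ a b c → c :- (a :- b) := b :+ c :- a) refl (dist x z) (dist x y) (dist y z)))
      (dist-Lipschitz x z y)

    dist≤weight : ∀ {u v} → u ~ v → 0# ≤ weight u v - dist u v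
    dist≤weight {u} {v} u~v = 0≤-resp-≈ (+-congʳ (+-identityʳ _)) (≤⇒0≤- (minimal (u~v ◅ ε)))

    ∑ᵥ-comm : ∀ (h : V → V → Carrier) → ∑ᵥ ℝ G (λ u → ∑ᵥ ℝ G (λ v → h u v)) ≈ ∑ᵥ ℝ G (λ v → ∑ᵥ ℝ G (λ u → h u v))
    ∑ᵥ-comm h = ∑-comm λ i j → h (vertex i) (vertex j)

    ∑ᵥ₂-distrib-- : ∀ (h h′ : V → V → Carrier) → ∑ᵥ ℝ G (λ u → ∑ᵥ ℝ G (λ v → h u v - h′ u v)) ≈
      ∑ᵥ ℝ G (λ u → ∑ᵥ ℝ G (λ v → h u v)) - ∑ᵥ ℝ G (λ u → ∑ᵥ ℝ G (λ v → h′ u v))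
    ∑ᵥ₂-distrib-- h h′ = trans (∑ᵥ-cong λ u → ∑ᵥ-distrib-- (h u) (h′ u))
      (∑ᵥ-distrib-- (λ u → ∑ᵥ ℝ G (h u)) (λ u → ∑ᵥ ℝ G (h′ u)))

    Wasserstein-lower : ∀ {f ρ σ m} → Lipschitz f → IsWasserstein ℝ G D ρ σ m →
      0# ≤ m - (∑ᵥ ℝ G (λ z → f z * ρ z) - ∑ᵥ ℝ G (λ z → f z * σ z))
    Wasserstein-lower {f} {ρ} {σ} lip (_ , greatest) = ≤⇒0≤- (greatest _ λ t (C , cost≈t) →
        0≤-⇒≤ (0≤-resp-≈ (+-congʳ cost≈t) (bound C)))
      where
      bound : ∀ (C : Coupling ℝ G ρ σ) →
        0# ≤ cost ℝ G D C - (∑ᵥ ℝ G (λ z → f z * ρ z) - ∑ᵥ ℝ G (λ z → f z * σ z))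
      bound C = 0≤-resp-≈ expand (∑ᵥ-0≤ _ λ u → ∑ᵥ-0≤ _ λ v →
          0≤-* (lip u v) (π-nonneg u v))
        where
        open Coupling C
        open import Relation.Binary.Reasoning.Setoid setoid
        expand : ∑ᵥ ℝ G (λ u → ∑ᵥ ℝ G (λ v → (dist u v - (f u - f v)) * π u v)) ≈
          cost ℝ G D C - (∑ᵥ ℝ G (λ z → f z * ρ z) - ∑ᵥ ℝ G (λ z → f z * σ z))
        expand = begin
          ∑ᵥ ℝ G (λ u → ∑ᵥ ℝ G (λ v → (dist u v - (f u - f v)) * π u v))
            ≈⟨ ∑ᵥ-cong (λ u → ∑ᵥ-cong λ v →
                 solve 4 (λ d a b p → (d :- (a :- b)) :* p := d :* p :- (a :* p :- b :* p))
                 refl (dist u v) (f u) (f v) (π u v)) ⟩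
          ∑ᵥ ℝ G (λ u → ∑ᵥ ℝ G (λ v → dist u v * π u v - (f u * π u v - f v * π u v)))
            ≈⟨ trans (∑ᵥ₂-distrib-- (λ u v → dist u v * π u v) (λ u v → f u * π u v - f v * π u v))
                 (+-congˡ (-‿cong (∑ᵥ₂-distrib-- (λ u v → f u * π u v) (λ u v → f v * π u v)))) ⟩
          cost ℝ G D C - (∑ᵥ ℝ G (λ u → ∑ᵥ ℝ G (λ v → f u * π u v)) - ∑ᵥ ℝ G (λ u → ∑ᵥ ℝ G (λ v → f v * π u v)))
            ≈⟨ +-congˡ (-‿cong (+-cong
                 (∑ᵥ-cong λ u → trans (∑ᵥ-*ˡ (f u) (π u)) (*-congˡ (marginal₁ u)))
                 (-‿cong (trans (∑ᵥ-comm λ u v → f v * π u v)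
                   (∑ᵥ-cong λ v → trans (∑ᵥ-*ˡ (f v) (λ u → π u v)) (*-congˡ (marginal₂ v))))))) ⟩
          cost ℝ G D C - (∑ᵥ ℝ G (λ z → f z * ρ z) - ∑ᵥ ℝ G (λ z → f z * σ z)) ∎

    Wasserstein-upper : ∀ {N ρ σ m} (amount : Fin N → Carrier) (source target : Fin N → V) →
      (∀ k → 0# ≤ amount k) →
      (∀ z → sum (λ k → amount k * δ (source k) z) ≈ ρ z) →
      (∀ z → sum (λ k → amount k * δ (target k) z) ≈ σ z) →
      IsWasserstein ℝ G D ρ σ m →
      0# ≤ sum (λ k → amount k * dist (source k) (target k)) - m
    Wasserstein-upper {N} {ρ} {σ} a s t 0≤a marginal-s marginal-t (least , _) =
      ≤⇒0≤- (least _ (plan , plan-cost))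
      where
      open import Relation.Binary.Reasoning.Setoid setoid
      π : V → V → Carrier
      π u v = sum (λ k → a k * (δ (s k) u * δ (t k) v))

      plan : Coupling ℝ G ρ σ
      plan = record
        { π         = π
        ; π-nonneg  = λ u v → sum-0≤ _ λ k →
            0≤-* (0≤a k) (0≤-* (indicator-0≤ (s k ≟ u)) (indicator-0≤ (t k ≟ v)))
        ; marginal₁ = λ u → begin
            ∑ᵥ ℝ G (λ v → sum (λ k → a k * (δ (s k) u * δ (t k) v)))
              ≈⟨ ∑ᵥ-sum-comm (λ v k → a k * (δ (s k) u * δ (t k) v)) ⟩
            sum (λ k → ∑ᵥ ℝ G (λ v → a k * (δ (s k) u * δ (t k) v)))
              ≈⟨ sum-cong-≋ (λ k → trans (∑ᵥ-cong λ v → sym (*-assoc (a k) (δ (s k) u) (δ (t k) v)))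
                   (∑ᵥ-δ (λ _ → a k * δ (s k) u) (t k))) ⟩
            sum (λ k → a k * δ (s k) u)
              ≈⟨ marginal-s u ⟩
            ρ u ∎
        ; marginal₂ = λ v → begin
            ∑ᵥ ℝ G (λ u → sum (λ k → a k * (δ (s k) u * δ (t k) v)))
              ≈⟨ ∑ᵥ-sum-comm (λ u k → a k * (δ (s k) u * δ (t k) v)) ⟩
            sum (λ k → ∑ᵥ ℝ G (λ u → a k * (δ (s k) u * δ (t k) v)))
              ≈⟨ sum-cong-≋ (λ k → trans
                   (∑ᵥ-cong λ u → solve 3 (λ x y z → x :* (y :* z) := x :* z :* y) refl (a k) (δ (s k) u) (δ (t k) v))
                   (∑ᵥ-δ (λ _ → a k * δ (t k) v) (s k))) ⟩
            sum (λ k → a k * δ (t k) v)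
              ≈⟨ marginal-t v ⟩
            σ v ∎
        }

      plan-cost : cost ℝ G D plan ≈ sum (λ k → a k * dist (s k) (t k))
      plan-cost = begin
        ∑ᵥ ℝ G (λ u → ∑ᵥ ℝ G (λ v → dist u v * π u v))
          ≈⟨ ∑ᵥ-cong (λ u → trans (∑ᵥ-cong λ v → *-distribˡ-sum (dist u v) (λ k → a k * (δ (s k) u * δ (t k) v)))
               (∑ᵥ-sum-comm λ v k → dist u v * (a k * (δ (s k) u * δ (t k) v)))) ⟩
        ∑ᵥ ℝ G (λ u → sum (λ k → ∑ᵥ ℝ G (λ v → dist u v * (a k * (δ (s k) u * δ (t k) v)))))
          ≈⟨ ∑ᵥ-cong (λ u → sum-cong-≋ λ k → trans
               (∑ᵥ-cong λ v → solve 4 (λ d x y z → d :* (x :* (y :* z)) := x :* d :* y :* z)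
                 refl (dist u v) (a k) (δ (s k) u) (δ (t k) v))
               (∑ᵥ-δ (λ v → a k * dist u v * δ (s k) u) (t k))) ⟩
        ∑ᵥ ℝ G (λ u → sum (λ k → a k * dist u (t k) * δ (s k) u))
          ≈⟨ ∑ᵥ-sum-comm (λ u k → a k * dist u (t k) * δ (s k) u) ⟩
        sum (λ k → ∑ᵥ ℝ G (λ u → a k * dist u (t k) * δ (s k) u))
          ≈⟨ sum-cong-≋ (λ k → ∑ᵥ-δ (λ u → a k * dist u (t k)) (s k)) ⟩
        sum (λ k → a k * dist (s k) (t k)) ∎

    module _ {x y : V} (x~y : x ~ y) {κ : Carrier} (curvature : IsCurvature ℝ G D x~y κ) where
      private
        r = dist x y
        0<r = dist-pos (~⇒≢ x~y)
        r⁻¹ = inverse r 0<r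

      rescale : ∀ {γ m k a a⁻¹} → a * a⁻¹ ≈ 1# → k ≈ 1# - m * r⁻¹ → ∀ s →
        r * a * (γ * r⁻¹ + s * (k * a⁻¹ - κ)) ≈ γ * a + s * (r - m - κ * r * a)
      rescale {γ} {m} {k} {a} {a⁻¹} aa⁻¹≈1 k≈ s = begin
        r * a * (γ * r⁻¹ + s * (k * a⁻¹ - κ))
          ≈⟨ solve 5 (λ r a g i z → r :* a :* (g :* i :+ z) := g :* a :* (r :* i) :+ r :* a :* z)
               refl r a γ r⁻¹ (s * (k * a⁻¹ - κ)) ⟩
        γ * a * (r * r⁻¹) + r * a * (s * (k * a⁻¹ - κ))
          ≈⟨ +-congˡ (solve 6 (λ r a s k j κ → r :* a :* (s :* (k :* j :- κ)) :=
               s :* (r :* k :* (a :* j) :- κ :* r :* a)) refl r a s k a⁻¹ κ) ⟩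
        γ * a * (r * r⁻¹) + s * (r * k * (a * a⁻¹) - κ * r * a)
          ≈⟨ +-cong (trans (*-congˡ rr⁻¹≈1) (*-identityʳ _))
               (*-congˡ (+-congʳ (trans (*-cong rk≈r-m aa⁻¹≈1) (*-identityʳ _)))) ⟩
        γ * a + s * (r - m - κ * r * a) ∎
        where
        open import Relation.Binary.Reasoning.Setoid setoid
        rr⁻¹≈1 = inverse-inverseʳ r 0<r
        rk≈r-m : r * k ≈ r - m
        rk≈r-m = trans (*-congˡ k≈) (trans
          (solve 3 (λ r m i → r :* (:1 :- m :* i) := r :- m :* (r :* i)) refl r m r⁻¹)
          (+-congˡ (-‿cong (trans (*-congˡ rr⁻¹≈1) (*-identityʳ m)))))

      curvature-approx : ∀ {γ b} → 0# < γ → 0# < b → ∃[ α ] ∃[ m ]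
        0# < 1# - α × 1# - α < b × IsWasserstein ℝ G D (μ ℝ G α x) (μ ℝ G α y) m ×
        0# < γ * (1# - α) - (r - m - κ * r * (1# - α)) ×
        0# < γ * (1# - α) + (r - m - κ * r * (1# - α))
      curvature-approx {γ} {b} 0<γ 0<b
        = α , m , 0<1-α , <-respˡ-≈ e≈1-α (<-trans e<e′ e′<b) , W
        , <-respʳ-≈ (trans (*-congˡ (solve 3 (λ g i z → g :* i :- z := g :* i :+ (:- :1) :* z) refl γ r⁻¹ (k * a⁻¹ - κ)))
            (trans (rescale aa⁻¹≈1 k≈ (- 1#))
              (solve 3 (λ g a z → g :* a :+ (:- :1) :* z := g :* a :- z) refl γ (1# - α) (r - m - κ * r * (1# - α)))))
            (*-pos (*-pos 0<r 0<1-α) (x<y⇒0<y-x above))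
        , <-respʳ-≈ (trans (*-congˡ (solve 4 (λ g i z κ → g :* i :- (κ :- z) := g :* i :+ :1 :* (z :- κ))
              refl γ r⁻¹ (k * a⁻¹) κ))
            (trans (rescale aa⁻¹≈1 k≈ 1#)
              (solve 3 (λ g a z → g :* a :+ :1 :* z := g :* a :+ z) refl γ (1# - α) (r - m - κ * r * (1# - α)))))
            (*-pos (*-pos 0<r 0<1-α) (x<y⇒0<y-x below))
        where
        limit = curvature (γ * r⁻¹) (*-pos 0<γ (inverse-pos r 0<r))
        η = proj₁ limit
        0<η = proj₁ (proj₂ limit)
        near = proj₂ (proj₂ limit)
        small = common-lower-bound 0<η 0<b
        e′ = proj₁ small
        e′<η = proj₁ (proj₂ (proj₂ small))
        e′<b = proj₂ (proj₂ (proj₂ small))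
        smaller = common-lower-bound (proj₁ (proj₂ small)) 0<1
        e = proj₁ smaller
        0<e = proj₁ (proj₂ smaller)
        e<e′ = proj₁ (proj₂ (proj₂ smaller))
        e<1 = proj₂ (proj₂ (proj₂ smaller))
        α = 1# - e
        e≈1-α : e ≈ 1# - α
        e≈1-α = solve 1 (λ e → e := :1 :- (:1 :- e)) refl e
        α<1 : α < 1#
        α<1 = 0<-⇒< (<-respʳ-≈ e≈1-α 0<e)
        1-η<α : 1# - η < α
        1-η<α = 0<-⇒< (<-respʳ-≈ (solve 2 (λ x e → x :- e := :1 :- e :- (:1 :- x)) refl η e)
          (x<y⇒0<y-x (<-trans e<e′ e′<η)))
        0<1-α = x<y⇒0<y-x α<1
        a⁻¹ = inverse (1# - α) 0<1-α
        aa⁻¹≈1 = inverse-inverseʳ (1# - α) 0<1-α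
        at-α = near α (pos⇒0≤ (x<y⇒0<y-x e<1)) α<1 1-η<α
        k = proj₁ at-α
        m = proj₁ (proj₁ (proj₂ at-α))
        W = proj₁ (proj₂ (proj₁ (proj₂ at-α)))
        k≈ = proj₂ (proj₂ (proj₁ (proj₂ at-α)))
        above = proj₁ (proj₂ (proj₂ at-α))
        below = proj₂ (proj₂ (proj₂ at-α))

      curvature-≤ : ∀ T → (∀ α m → 0# < 1# - α → IsWasserstein ℝ G D (μ ℝ G α x) (μ ℝ G α y) m →
        0# ≤ m - (r - (1# - α) * T)) → 0# ≤ T - κ * r
      curvature-≤ T bound T-κr<0 =
        let α , m , 0<1-α , _ , W , above , below = curvature-approx (neg⇒0<- T-κr<0) 0<1
        in pos+0≤≉0 below (bound α m 0<1-α W)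
            (solve 5 (λ t κ r m a → (:- (t :- κ :* r)) :* a :+ (r :- m :- κ :* r :* a) :+ (m :- (r :- a :* t)) := :0)
              refl T κ r m (1# - α))

      curvature-≥ : ∀ T b → 0# < b →
        (∀ α m → 0# < 1# - α → 1# - α < b → IsWasserstein ℝ G D (μ ℝ G α x) (μ ℝ G α y) m →
          0# ≤ r - (1# - α) * T - m) → 0# ≤ κ * r - T
      curvature-≥ T b 0<b bound κr-T<0 =
        let α , m , 0<1-α , 1-α<b , W , above , below = curvature-approx (neg⇒0<- κr-T<0) 0<b
        in pos+0≤≉0 above (bound α m 0<1-α 1-α<b W)
            (solve 5 (λ t κ r m a → (:- (κ :* r :- t)) :* a :- (r :- m :- κ :* r :* a) :+ (r :- a :* t :- m) := :0)
              refl T κ r m (1# - α))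

module Cycle where

  prev : ∀ {g} → Fin g → Fin g
  prev {suc n} i = (toℕ i ℕ.+ n) mod suc n

  toℕ-mod′ : ∀ k n → toℕ (k mod suc n) ≡ k % suc n
  toℕ-mod′ k n = Fin.toℕ-fromℕ< _

  next-prev : ∀ {g} (i : Fin g) → next (prev i) ≡ i
  next-prev {suc n} i = ≡.trans (mod-next (toℕ i ℕ.+ n) n) (Fin.toℕ-injective (begin
    toℕ (suc (toℕ i ℕ.+ n) mod suc n)  ≡⟨ toℕ-mod′ (suc (toℕ i ℕ.+ n)) n ⟩
    suc (toℕ i ℕ.+ n) % suc n          ≡⟨ ≡.cong (_% suc n) (ℕ.+-suc (toℕ i) n) ⟨
    (toℕ i ℕ.+ suc n) % suc n          ≡⟨ [m+n]%n≡m%n (toℕ i) (suc n) ⟩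
    toℕ i % suc n                      ≡⟨ m<n⇒m%n≡m (Fin.toℕ<n i) ⟩
    toℕ i                              ∎))
    where open ≡.≡-Reasoning

  prev-next : ∀ {g} (i : Fin g) → prev (next i) ≡ i
  prev-next {suc n} i = Fin.toℕ-injective (begin
    toℕ (prev (next i))                               ≡⟨ toℕ-mod′ (toℕ (next i) ℕ.+ n) n ⟩
    (toℕ (next i) ℕ.+ n) % suc n                      ≡⟨ ≡.cong (λ k → (k ℕ.+ n) % suc n) (toℕ-mod′ (suc (toℕ i)) n) ⟩
    (suc (toℕ i) % suc n ℕ.+ n) % suc n               ≡⟨ %-distribˡ-+ (suc (toℕ i) % suc n) n (suc n) ⟩
    (suc (toℕ i) % suc n % suc n ℕ.+ n % suc n) % suc n
      ≡⟨ ≡.cong (λ k → (k ℕ.+ n % suc n) % suc n) (m%n%n≡m%n (suc (toℕ i)) (suc n)) ⟩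
    (suc (toℕ i) % suc n ℕ.+ n % suc n) % suc n       ≡⟨ %-distribˡ-+ (suc (toℕ i)) n (suc n) ⟨
    suc (toℕ i ℕ.+ n) % suc n                         ≡⟨ ≡.cong (_% suc n) (ℕ.+-suc (toℕ i) n) ⟨
    (toℕ i ℕ.+ suc n) % suc n                         ≡⟨ [m+n]%n≡m%n (toℕ i) (suc n) ⟩
    toℕ i % suc n                                     ≡⟨ m<n⇒m%n≡m (Fin.toℕ<n i) ⟩
    toℕ i                                             ∎)
    where open ≡.≡-Reasoning

  next-permutation : ∀ {g} → Permutation g g
  next-permutation = permutation next prev next-prev prev-next

  next-next≢ : ∀ {g} → 3 ℕ.≤ g → (i : Fin g) → next (next i) ≢ i
  next-next≢ {suc n} g≥3 i eq = ¬2≡multiple (suc (suc (toℕ i)) / suc n) (ℕ.+-cancelˡ-≡ (toℕ i) _ _ (begin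
    toℕ i ℕ.+ 2                                                    ≡⟨ ℕ.+-comm (toℕ i) 2 ⟩
    2 ℕ.+ toℕ i                                                    ≡⟨ m≡m%n+[m/n]*n (2 ℕ.+ toℕ i) (suc n) ⟩
    (2 ℕ.+ toℕ i) % suc n ℕ.+ (2 ℕ.+ toℕ i) / suc n ℕ.* suc n      ≡⟨ ≡.cong (ℕ._+ (2 ℕ.+ toℕ i) / suc n ℕ.* suc n) 2+i%≡i ⟩
    toℕ i ℕ.+ (2 ℕ.+ toℕ i) / suc n ℕ.* suc n                      ∎))
    where
    open ≡.≡-Reasoning
    2+i%≡i : (2 ℕ.+ toℕ i) % suc n ≡ toℕ i
    2+i%≡i = ≡.trans (≡.sym (toℕ-mod′ (2 ℕ.+ toℕ i) n))
      (≡.cong toℕ (≡.trans (≡.sym (mod-next (suc (toℕ i)) n)) eq))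
    ¬2≡multiple : ∀ q → 2 ≢ q ℕ.* suc n
    ¬2≡multiple zero    ()
    ¬2≡multiple (suc q) eq = ℕ.<⇒≢ (ℕ.<-≤-trans g≥3 (ℕ.m≤m+n (suc n) (q ℕ.* suc n))) eq

  record Sides {g} (x a b : Fin g) : Set where
    field
      distinct   : a ≢ b
      adjacentˡ  : a ≡ next x ⊎ x ≡ next a
      adjacentʳ  : b ≡ next x ⊎ x ≡ next b
      exhaustive : ∀ {z} → z ≡ next x ⊎ x ≡ next z → z ≡ a ⊎ z ≡ b

  sides : ∀ {g} → 3 ℕ.≤ g → (x : Fin g) → Sides x (next x) (prev x)
  sides g≥3 x = record
    { distinct   = λ eq → next-next≢ g≥3 x (≡.trans (≡.cong next eq) (next-prev x))
    ; adjacentˡ  = inj₁ ≡.refl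
    ; adjacentʳ  = inj₂ (≡.sym (next-prev x))
    ; exhaustive = λ
      { (inj₁ z≡)    → inj₁ z≡
      ; (inj₂ ≡.refl) → inj₂ (≡.sym (prev-next _)) }
    }

  Sides-swap : ∀ {g} {x a b : Fin g} → Sides x a b → Sides x b a
  Sides-swap s = record
    { distinct   = λ eq → distinct (≡.sym eq)
    ; adjacentˡ  = adjacentʳ
    ; adjacentʳ  = adjacentˡ
    ; exhaustive = λ z → swap (exhaustive z)
    }
    where open Sides s

  sides-next : ∀ {g} → 3 ℕ.≤ g → (x : Fin g) → Sides (next x) x (next (next x))
  sides-next g≥3 x = Sides-swap (≡.subst (Sides (next x) (next (next x)))
    (prev-next x) (sides g≥3 (next x)))

  sides-prev : ∀ {g} → 3 ℕ.≤ g → (x : Fin g) → Sides (prev x) x (prev (prev x))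
  sides-prev g≥3 x = ≡.subst (λ y → Sides (prev x) y (prev (prev x)))
    (next-prev x) (sides g≥3 (prev x))

module SunGraph {c ℓ₁ ℓ₂} (ℝ : RealNumbers c ℓ₁ ℓ₂) (g n : ℕ) (g≥3 : 3 ℕ.≤ g) where
  open Cycle
  open OrderedField ℝ
  private
    G : Graph
    G = S g (2 ℕ.+ n) g≥3
  open Transport ℝ G
  open Graph G using (V; Walk; _~_; degree; ~⇒≢)

  neighbour : Fin g → Fin g → Fin g → Fin (2 ℕ.+ n) → V
  neighbour x a b zero          = cyc a
  neighbour x a b (suc zero)    = cyc b
  neighbour x a b (suc (suc j)) = leaf x j

  cycle-neighbours : ∀ {x a b} → Sides x a b → Enumerates (cyc x) (neighbour x a b)
  cycle-neighbours {x} {a} {b} s = record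
    { injective  = inj
    ; adjacent   = adj
    ; exhaustive = exh
    }
    where
    open Sides s
    inj : ∀ i j → neighbour x a b i ≡ neighbour x a b j → i ≡ j
    inj zero          zero           eq     = ≡.refl
    inj zero          (suc zero)     ≡.refl = contradiction ≡.refl distinct
    inj (suc zero)    zero           ≡.refl = contradiction ≡.refl distinct
    inj (suc zero)    (suc zero)     eq     = ≡.refl
    inj (suc (suc i)) (suc (suc .i)) ≡.refl = ≡.refl
    adj : ∀ i → cyc x ~ neighbour x a b i
    adj zero          = adjacentˡ
    adj (suc zero)    = adjacentʳ
    adj (suc (suc j)) = ≡.refl
    exh : ∀ z → cyc x ~ z → ∃[ i ] neighbour x a b i ≡ z
    exh (cyc z) x~z with exhaustive x~z
    ... | inj₁ z≡a = zero , ≡.cong inj₁ (≡.sym z≡a)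
    ... | inj₂ z≡b = suc zero , ≡.cong inj₁ (≡.sym z≡b)
    exh (leaf i j) ≡.refl = suc (suc j) , ≡.refl

  leaf-neighbours : ∀ x j → Enumerates (leaf x j) (λ (_ : Fin 1) → cyc x)
  leaf-neighbours x j = record
    { injective  = λ { zero zero _ → ≡.refl }
    ; adjacent   = λ _ → ≡.refl
    ; exhaustive = λ { (cyc z) ≡.refl → zero , ≡.refl }
    }

  N ν u : Carrier
  N = fromℕ (2 ℕ.+ n)
  ν = fromℕ n
  u = 1/ (2 ℕ.+ n)

  Nu≈1 : N * u ≈ 1#
  Nu≈1 = 1/-inverse (1 ℕ.+ n)

  0<N : 0# < N
  0<N = 0<fromℕ (1 ℕ.+ n)

  0<u : 0# < u
  0<u = inverse-pos N 0<N

  inverse-unique : ∀ {m x y} → m * x ≈ 1# → m * y ≈ 1# → x ≈ y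
  inverse-unique {m} {x} {y} mx≈1 my≈1 = begin
    x             ≈⟨ *-identityʳ x ⟨
    x * 1#        ≈⟨ *-congˡ my≈1 ⟨
    x * (m * y)   ≈⟨ solve 3 (λ m x y → x :* (m :* y) := m :* x :* y) refl m x y ⟩
    m * x * y     ≈⟨ *-congʳ mx≈1 ⟩
    1# * y        ≈⟨ *-identityˡ y ⟩
    y             ∎
    where open import Relation.Binary.Reasoning.Setoid setoid

  1/degree-cyc : ∀ {x a b} → Sides x a b → 1/ degree (cyc x) ≈ u
  1/degree-cyc s = inverse-unique (1/degree-inverse (cycle-neighbours s)) Nu≈1

  1/degree-leaf : ∀ x j → 1/ degree (leaf x j) ≈ 1#
  1/degree-leaf x j = inverse-unique (1/degree-inverse (leaf-neighbours x j))
    (trans (*-identityʳ _) (+-identityʳ 1#))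

  ∑ᵥ-μ-cyc : ∀ {x a b} → Sides x a b → ∀ (f : V → Carrier) α →
    ∑ᵥ ℝ G (λ z → f z * μ ℝ G α (cyc x) z) ≈
    α * f (cyc x) + (1# - α) * u * (f (cyc a) + (f (cyc b) + sum λ j → f (leaf x j)))
  ∑ᵥ-μ-cyc s f α = trans (∑ᵥ-μ (cycle-neighbours s) f α)
    (+-congˡ (*-congʳ (*-congˡ (1/degree-cyc s))))

  ∑ᵥ-μ-leaf : ∀ x j (f : V → Carrier) α →
    ∑ᵥ ℝ G (λ z → f z * μ ℝ G α (leaf x j) z) ≈
    α * f (leaf x j) + (1# - α) * f (cyc x)
  ∑ᵥ-μ-leaf x j f α = trans (∑ᵥ-μ (leaf-neighbours x j) f α)
    (+-congˡ (*-cong (trans (*-congˡ (1/degree-leaf x j)) (*-identityʳ _)) (+-identityʳ _)))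

  clear-denominator : ∀ A B → N * (A + u * B) ≈ N * A + B
  clear-denominator A B = trans (solve 4 (λ N A u B → N :* (A :+ u :* B) := N :* A :+ N :* u :* B) refl N A u B)
    (+-congˡ (trans (*-congʳ Nu≈1) (*-identityˡ B)))

  sum-shift : ∀ A (t : Fin n → Carrier) → sum (λ j → A + t j) ≈ ν * A + sum t
  sum-shift A t = trans (∑-distrib-+ (λ _ → A) t) (+-congʳ (sum-const n A))

  signed : ∀ {P : Set} → Dec P → Carrier → Carrier
  signed (yes _) x = - x
  signed (no _)  x = x

  signed-true : ∀ {P : Set} (P? : Dec P) x → P → signed P? x ≈ - x
  signed-true (yes _) x p = refl
  signed-true (no ¬p) x p = contradiction p ¬p

  signed-false : ∀ {P : Set} (P? : Dec P) x → ¬ P → signed P? x ≈ x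
  signed-false (yes p) x ¬p = contradiction p ¬p
  signed-false (no _)  x ¬p = refl

  signed-≤ : ∀ {P : Set} (P? : Dec P) {x} → 0# < x → 0# ≤ x - signed P? x
  signed-≤ (yes _) {x} 0<x = 0≤-resp-≈ (solve 1 (λ x → x :+ x := x :- (:- x)) refl x) (pos⇒0≤ (x+y-pos 0<x 0<x))
  signed-≤ (no _)  {x} 0<x = 0≤-resp-≈ (sym (-‿inverseʳ x)) 0≤0

  signed-≥ : ∀ {P : Set} (P? : Dec P) {x} → 0# < x → 0# ≤ x + signed P? x
  signed-≥ (yes _) {x} 0<x = 0≤-resp-≈ (sym (-‿inverseʳ x)) 0≤0
  signed-≥ (no _)  {x} 0<x = pos⇒0≤ (x+y-pos 0<x 0<x)

  module _ (w : Weighting ℝ G) (D : Distance ℝ G w) where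
    open Weighting w
    open Distance D

    ω : Fin g → Fin g → Carrier
    ω i j = weight (cyc i) (cyc j)

    ϱ : Fin g → Fin g → Carrier
    ϱ i j = dist (cyc i) (cyc j)

    leafWeight : Fin g → Fin n → Carrier
    leafWeight i j = weight (cyc i) (leaf i j)

    Λ : Fin g → Carrier
    Λ i = sum (leafWeight i)

    leafWeight-pos : ∀ i j → 0# < leafWeight i j
    leafWeight-pos i j = weight-pos {cyc i} {leaf i j} ≡.refl

    -- P? selects the leaves that lie behind cyc y, seen from the edge whose
    -- curvature is being bounded; the potential decreases towards them.
    potential : Fin g → {P : Fin g → Fin n → Set} → (∀ i j → Dec (P i j)) → V → Carrier
    potential y P? (cyc i)    = ϱ y i
    potential y P? (leaf i j) = ϱ y i + signed (P? i j) (leafWeight i j)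

    potential-Lipschitz : ∀ y {P : Fin g → Fin n → Set} (P? : ∀ i j → Dec (P i j)) →
      Lipschitz D (potential y P?)
    potential-Lipschitz y P? = edgewise⇒Lipschitz D (potential y P?) λ {a} {b} → edge a b
      where
      edge : ∀ a b → a ~ b → 0# ≤ weight a b - (potential y P? a - potential y P? b)
      edge (cyc i) (cyc k) i~k = 0≤-resp-≈
        (solve 3 (λ a b c → a :+ b :- c := b :- (c :- a)) refl (ϱ y k) (ω i k) (ϱ y i))
        (dist-step D (cyc y) i~k)
      edge (cyc i) (leaf .i j) ≡.refl = 0≤-resp-≈
        (solve 3 (λ a b c → a :+ b := a :- (c :- (c :+ b))) refl
          (leafWeight i j) (signed (P? i j) (leafWeight i j)) (ϱ y i))
        (signed-≥ (P? i j) (leafWeight-pos i j))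
      edge (leaf i j) (cyc .i) ≡.refl = 0≤-resp-≈
        (trans (+-congʳ (weight-sym {cyc i} {leaf i j} ≡.refl))
          (solve 3 (λ a b c → a :- b := a :- (c :+ b :- c)) refl
            (weight (leaf i j) (cyc i)) (signed (P? i j) (leafWeight i j)) (ϱ y i)))
        (signed-≤ (P? i j) (leafWeight-pos i j))

    dist-leaf : ∀ y j → dist (cyc y) (leaf y j) ≈ leafWeight y j
    dist-leaf y j = trans (solve 2 (λ a b → a := a :- b :+ b) refl r ℓ)
      (trans (+-congʳ (≈0-of-0≤ ℓ≤r (0≤-resp-≈ (solve 2 (λ a b → b :- a := :- (a :- b)) refl r ℓ)
        (dist≤weight D {cyc y} {leaf y j} ≡.refl)))) (+-identityˡ ℓ))
      where
      r = dist (cyc y) (leaf y j)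
      ℓ = leafWeight y j
      ℓ≤r : 0# ≤ r - ℓ
      ℓ≤r = 0≤-resp-≈ (solve 3 (λ r ℓ x → r :- (x :- (x :+ :- ℓ)) := r :- ℓ) refl r ℓ (ϱ y y))
        (potential-Lipschitz y {λ _ _ → ⊤} (λ _ _ → yes tt) (cyc y) (leaf y j))

    module _ (κ : Carrier) where

      cycle-edge-bound : ∀ {x y x′ y′} → Sides x y x′ → Sides y x y′ → (x~y : cyc x ~ cyc y) →
        IsCurvature ℝ G D {cyc x} {cyc y} x~y κ →
        0# ≤ ϱ x y + ϱ x y + ϱ x y + ϱ y y′ - (ϱ y x′ + Λ x + Λ y) - N * κ * ϱ x y
      cycle-edge-bound {x} {y} {x′} {y′} sx sy x~y curvature = 0≤-resp-≈ simplify
          (0≤-* (pos⇒0≤ 0<N) (curvature-≤ D {cyc x} {cyc y} x~y curvature (A + u * (A + Q - P))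
            λ α m 0<e W → 0≤-resp-≈ (+-congˡ (-‿cong (difference α)))
              (Wasserstein-lower D (potential-Lipschitz y flipped?) W)))
        where
        open import Relation.Binary.Reasoning.Setoid setoid
        A = ϱ x y
        P = ϱ y x′ + (ν * A + Λ x)
        Q = ϱ y y′ + (ν * 0# + - Λ y)
        flipped? : ∀ i (j : Fin n) → Dec (i ≡ y)
        flipped? i j = i Fin.≟ y
        f = potential y flipped?
        x≢y : x ≢ y
        x≢y x≡y = ~⇒≢ {cyc x} {cyc y} x~y (≡.cong inj₁ x≡y)

        leaves-x : sum (λ j → f (leaf x j)) ≈ ν * A + Λ x
        leaves-x = trans (sum-cong-≋ λ j → +-cong (dist-sym D (cyc y) (cyc x))
          (signed-false (x Fin.≟ y) (leafWeight x j) x≢y)) (sum-shift A (leafWeight x))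

        leaves-y : sum (λ j → f (leaf y j)) ≈ ν * 0# + - Λ y
        leaves-y = trans (sum-cong-≋ λ j → +-cong (dist-refl D (cyc y))
          (signed-true (y Fin.≟ y) (leafWeight y j) ≡.refl))
          (trans (sum-shift 0# (λ j → - leafWeight y j)) (+-congˡ (sum-neg (leafWeight y))))

        difference : ∀ α →
          ∑ᵥ ℝ G (λ z → f z * μ ℝ G α (cyc x) z) -
          ∑ᵥ ℝ G (λ z → f z * μ ℝ G α (cyc y) z) ≈
          A - (1# - α) * (A + u * (A + Q - P))
        difference α = trans
          (+-cong
            (trans (∑ᵥ-μ-cyc sx f α) (+-cong (*-congˡ (dist-sym D (cyc y) (cyc x)))
              (*-congˡ (+-cong (dist-refl D (cyc y)) (+-congˡ leaves-x)))))
            (-‿cong (trans (∑ᵥ-μ-cyc sy f α) (+-cong (*-congˡ (dist-refl D (cyc y)))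
              (*-congˡ (+-cong (dist-sym D (cyc y) (cyc x)) (+-congˡ leaves-y)))))))
          (solve 5 (λ α A u P Q →
            α :* A :+ (:1 :- α) :* u :* (:0 :+ P) :- (α :* :0 :+ (:1 :- α) :* u :* (A :+ Q)) :=
            A :- (:1 :- α) :* (A :+ u :* (A :+ Q :- P))) refl α A u P Q)

        simplify : N * (A + u * (A + Q - P) - κ * A) ≈
          A + A + A + ϱ y y′ - (ϱ y x′ + Λ x + Λ y) - N * κ * A
        simplify = trans (solve 4 (λ N T κ A → N :* (T :- κ :* A) := N :* T :- N :* κ :* A) refl
            N (A + u * (A + Q - P)) κ A)
          (+-congʳ (trans (clear-denominator A (A + Q - P))
            (solve 6 (λ ν A F G Λx Λy →
              (:1 :+ (:1 :+ ν)) :* A :+ (A :+ (G :+ (ν :* :0 :+ :- Λy)) :- (F :+ (ν :* A :+ Λx))) :=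
              A :+ A :+ A :+ G :- (F :+ Λx :+ Λy)) refl ν A (ϱ y x′) (ϱ y y′) (Λ x) (Λ y))))

      leaf-edge-bound : ∀ {y a b} → Sides y a b → ∀ j →
        IsCurvature ℝ G D {cyc y} {leaf y j} ≡.refl κ →
        0# ≤ (N + 1# + 1# - N * κ) * leafWeight y j - (ϱ y a + ϱ y b + Λ y)
      leaf-edge-bound {y} {a} {b} sy j₀ curvature = 0≤-resp-≈ simplify
          (0≤-* (pos⇒0≤ 0<N) (0≤-resp-≈ (+-congˡ (-‿cong (*-congˡ (dist-leaf y j₀))))
            (curvature-≤ D {cyc y} {leaf y j₀} ≡.refl curvature (ℓ + u * (- R))
              λ α m 0<e W → 0≤-resp-≈ (+-congˡ (-‿cong (difference α)))
                (Wasserstein-lower D (potential-Lipschitz y flipped?) W))))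
        where
        ℓ = leafWeight y j₀
        R = ϱ y a + (ϱ y b + (ν * 0# + (Λ y - (ℓ + ℓ))))
        flipped? : ∀ i j → Dec (i ≡ y × j ≡ j₀)
        flipped? i j = (i Fin.≟ y) ×-dec (j Fin.≟ j₀)
        f = potential y flipped?

        signed-indicator : ∀ {P : Set} (P? : Dec P) x → signed P? x ≈ x - indicator P? * (x + x)
        signed-indicator (yes _) x = solve 1 (λ x → :- x := x :- :1 :* (x :+ x)) refl x
        signed-indicator (no _)  x = solve 1 (λ x → x := x :- :0 :* (x :+ x)) refl x

        leaves : sum (λ j → f (leaf y j)) ≈ ν * 0# + (Λ y - (ℓ + ℓ))
        leaves = trans (sum-cong-≋ λ j → +-cong (dist-refl D (cyc y))
            (signed-indicator (flipped? y j) (leafWeight y j)))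
          (trans (sum-shift 0# (λ j → leafWeight y j - flip j)) (+-congˡ
            (trans (∑-distrib-- (leafWeight y) flip) (+-congˡ (-‿cong (trans
              (sum-single flip j₀ λ j j≢j₀ → trans (*-congʳ (indicator-false (flipped? y j) λ (_ , j≡) → j≢j₀ j≡))
                (zeroˡ _))
              (trans (*-congʳ (indicator-true (flipped? y j₀) (≡.refl , ≡.refl))) (*-identityˡ _))))))))
          where
          flip : Fin n → Carrier
          flip j = indicator (flipped? y j) * (leafWeight y j + leafWeight y j)

        difference : ∀ α →
          ∑ᵥ ℝ G (λ z → f z * μ ℝ G α (cyc y) z) -
          ∑ᵥ ℝ G (λ z → f z * μ ℝ G α (leaf y j₀) z) ≈
          dist (cyc y) (leaf y j₀) - (1# - α) * (ℓ + u * (- R))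
        difference α = trans
          (+-cong
            (trans (∑ᵥ-μ-cyc sy f α) (+-cong (*-congˡ (dist-refl D (cyc y)))
              (*-congˡ (+-congˡ (+-congˡ leaves)))))
            (-‿cong (trans (∑ᵥ-μ-leaf y j₀ f α) (+-cong
              (*-congˡ (+-cong (dist-refl D (cyc y)) (signed-true (flipped? y j₀) ℓ (≡.refl , ≡.refl))))
              (*-congˡ (dist-refl D (cyc y)))))))
          (trans (solve 4 (λ α u ℓ R →
            α :* :0 :+ (:1 :- α) :* u :* R :- (α :* (:0 :+ :- ℓ) :+ (:1 :- α) :* :0) :=
            ℓ :- (:1 :- α) :* (ℓ :+ u :* (:- R))) refl α u ℓ R)
            (+-congʳ (sym (dist-leaf y j₀))))

        simplify : N * (ℓ + u * (- R) - κ * ℓ) ≈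
          (N + 1# + 1# - N * κ) * ℓ - (ϱ y a + ϱ y b + Λ y)
        simplify = trans (solve 4 (λ N T κ A → N :* (T :- κ :* A) := N :* T :- N :* κ :* A) refl
            N (ℓ + u * (- R)) κ ℓ)
          (trans (+-congʳ (clear-denominator ℓ (- R)))
            (solve 7 (λ N κ ℓ a b Λy ν →
              N :* ℓ :+ :- (a :+ (b :+ (ν :* :0 :+ (Λy :- (ℓ :+ ℓ))))) :- N :* κ :* ℓ :=
              (N :+ :1 :+ :1 :- N :* κ) :* ℓ :- (a :+ b :+ Λy))
              refl N κ ℓ (ϱ y a) (ϱ y b) (Λ y) ν))

      leaves-bound : ∀ {y a b} → Sides y a b →
        (∀ j → IsCurvature ℝ G D {cyc y} {leaf y j} ≡.refl κ) →
        0# ≤ (1# + 1# + 1# + 1# - N * κ) * Λ y - ν * (ϱ y a + ϱ y b)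
      leaves-bound {y} {a} {b} sy curvature = 0≤-resp-≈
        (trans (∑-distrib-- (λ j → (N + 1# + 1# - N * κ) * leafWeight y j) (λ _ → ϱ y a + ϱ y b + Λ y))
          (trans (+-cong (sym (*-distribˡ-sum (N + 1# + 1# - N * κ) (leafWeight y)))
                   (-‿cong (sum-const n (ϱ y a + ϱ y b + Λ y))))
            (solve 4 (λ ν K Λy s →
              (:1 :+ (:1 :+ ν) :+ :1 :+ :1 :- K) :* Λy :- ν :* (s :+ Λy) :=
              (:1 :+ :1 :+ :1 :+ :1 :- K) :* Λy :- ν :* s) refl ν (N * κ) (Λ y) (ϱ y a + ϱ y b))))
        (sum-0≤ _ λ j → leaf-edge-bound sy j (curvature j))

      coupled-edge-bound : ∀ {x y x′ y′} → Sides x y x′ → Sides y x y′ → (x~y : cyc x ~ cyc y) →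
        IsCurvature ℝ G D {cyc x} {cyc y} x~y κ →
        0# ≤ N * κ * ϱ x y + ϱ x′ y′ + Λ x + Λ y - (ϱ x y + ϱ x y + ϱ x y)
      coupled-edge-bound {x} {y} {x′} {y′} sx sy x~y curvature = 0≤-resp-≈ simplify
          (0≤-+ leaves-0≤ (0≤-* (pos⇒0≤ 0<N)
            (curvature-≥ D {cyc x} {cyc y} x~y curvature (A + u * (A - (M + L))) u 0<u bound)))
        where
        A = ϱ x y
        M = ϱ x′ y′
        leafDist : Fin n → Carrier
        leafDist j = dist (leaf x j) (leaf y j)
        L = sum leafDist

        leafDist≤ : ∀ j → 0# ≤ A + (leafWeight x j + leafWeight y j) - leafDist j
        leafDist≤ j = 0≤-resp-≈
          (solve 6 (λ a ℓ ℓ′ d e f → (d :+ e :- f) :+ (a :+ ℓ′ :- e) :+ (ℓ :- d) := a :+ (ℓ :+ ℓ′) :- f)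
            refl A (leafWeight x j) (leafWeight y j) (dist (leaf x j) (cyc x)) (dist (cyc x) (leaf y j)) (leafDist j))
          (0≤-+ (0≤-+ (dist-triangle D (leaf x j) (cyc x) (leaf y j))
            (0≤-resp-≈ (+-congʳ (+-congˡ (dist-leaf y j))) (dist-triangle D (cyc x) (cyc y) (leaf y j))))
            (0≤-resp-≈ (+-congˡ (-‿cong (dist-sym D (cyc x) (leaf x j))))
              (dist≤weight D {cyc x} {leaf x j} ≡.refl)))

        leaves-0≤ : 0# ≤ ν * A + (Λ x + Λ y) - L
        leaves-0≤ = 0≤-resp-≈
          (trans (∑-distrib-- (λ j → A + (leafWeight x j + leafWeight y j)) leafDist)
            (+-congʳ (trans (sum-shift A (λ j → leafWeight x j + leafWeight y j))
              (+-congˡ (∑-distrib-+ (leafWeight x) (leafWeight y))))))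
          (sum-0≤ _ leafDist≤)

        -- The mass shared by both measures at x and y stays, x′ is matched
        -- with y′, leaves with leaves, and the rest of the atom at x goes to y.
        amount : Carrier → Fin (4 ℕ.+ n) → Carrier
        amount α zero    = α - (1# - α) * u
        amount α (suc _) = (1# - α) * u

        source target : Fin (4 ℕ.+ n) → V
        source zero                      = cyc x
        source (suc zero)                = cyc x
        source (suc (suc zero))          = cyc y
        source (suc (suc (suc zero)))    = cyc x′
        source (suc (suc (suc (suc j)))) = leaf x j
        target zero                      = cyc y
        target (suc zero)                = cyc x
        target (suc (suc zero))          = cyc y
        target (suc (suc (suc zero)))    = cyc y′
        target (suc (suc (suc (suc j)))) = leaf y j

        bound : ∀ α m → 0# < 1# - α → 1# - α < u →
          IsWasserstein ℝ G D
            (μ ℝ G α (cyc x)) (μ ℝ G α (cyc y)) m →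
          0# ≤ A - (1# - α) * (A + u * (A - (M + L))) - m
        bound α m 0<e e<u W = 0≤-resp-≈ (+-congʳ total)
            (Wasserstein-upper D (amount α) source target amount-0≤ marginal-x marginal-y W)
          where
          e = 1# - α

          α-0≤ : 0# ≤ α
          α-0≤ = 0≤-resp-≈
            (trans (solve 3 (λ α ν u → (u :- (:1 :- α)) :+ (u :+ ν :* u) :=
                α :- :1 :+ (:1 :+ (:1 :+ ν)) :* u) refl α ν u)
              (trans (+-congˡ Nu≈1) (solve 1 (λ α → α :- :1 :+ :1 := α) refl α)))
            (0≤-+ (pos⇒0≤ (x<y⇒0<y-x e<u)) (0≤-+ (pos⇒0≤ 0<u) (0≤-* (fromℕ-0≤ n) (pos⇒0≤ 0<u))))

          amount-0≤ : ∀ k → 0# ≤ amount α k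
          amount-0≤ (suc k) = 0≤-* (pos⇒0≤ 0<e) (pos⇒0≤ 0<u)
          amount-0≤ zero    = 0≤-resp-≈
            (trans (solve 3 (λ α ν u → (u :- (:1 :- α)) :+ (α :* u :+ ν :* u) :=
                α :- (:1 :- α) :* u :- :1 :+ (:1 :+ (:1 :+ ν)) :* u) refl α ν u)
              (trans (+-congˡ Nu≈1) (solve 1 (λ α → α :- :1 :+ :1 := α) refl (α - (1# - α) * u))))
            (0≤-+ (pos⇒0≤ (x<y⇒0<y-x e<u))
              (0≤-+ (0≤-* α-0≤ (pos⇒0≤ 0<u)) (0≤-* (fromℕ-0≤ n) (pos⇒0≤ 0<u))))

          marginal-x : ∀ z → sum (λ k → amount α k * δ (source k) z) ≈ μ ℝ G α (cyc x) z
          marginal-x z = trans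
            (+-congˡ (+-congˡ (+-congˡ (+-congˡ (sym (*-distribˡ-sum (e * u) (λ j → δ (leaf x j) z)))))))
            (trans (solve 6 (λ α u a b c s →
                (α :- (:1 :- α) :* u) :* a :+ ((:1 :- α) :* u :* a :+
                  ((:1 :- α) :* u :* b :+ ((:1 :- α) :* u :* c :+ (:1 :- α) :* u :* s))) :=
                α :* a :+ (:1 :- α) :* u :* (b :+ (c :+ s)))
                refl α u (δ (cyc x) z) (δ (cyc y) z) (δ (cyc x′) z) (sum λ j → δ (leaf x j) z))
              (sym (trans (μ-expand (cycle-neighbours sx) α z) (+-congˡ (*-congʳ (*-congˡ (1/degree-cyc sx)))))))

          marginal-y : ∀ z → sum (λ k → amount α k * δ (target k) z) ≈ μ ℝ G α (cyc y) z
          marginal-y z = trans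
            (+-congˡ (+-congˡ (+-congˡ (+-congˡ (sym (*-distribˡ-sum (e * u) (λ j → δ (leaf y j) z)))))))
            (trans (solve 6 (λ α u a b c s →
                (α :- (:1 :- α) :* u) :* a :+ ((:1 :- α) :* u :* b :+
                  ((:1 :- α) :* u :* a :+ ((:1 :- α) :* u :* c :+ (:1 :- α) :* u :* s))) :=
                α :* a :+ (:1 :- α) :* u :* (b :+ (c :+ s)))
                refl α u (δ (cyc y) z) (δ (cyc x) z) (δ (cyc y′) z) (sum λ j → δ (leaf y j) z))
              (sym (trans (μ-expand (cycle-neighbours sy) α z) (+-congˡ (*-congʳ (*-congˡ (1/degree-cyc sy)))))))

          total : sum (λ k → amount α k * dist (source k) (target k)) ≈ A - e * (A + u * (A - (M + L)))
          total = trans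
            (+-congˡ (+-cong (*-congˡ (dist-refl D (cyc x))) (+-cong (*-congˡ (dist-refl D (cyc y)))
              (+-congˡ (sym (*-distribˡ-sum (e * u) leafDist))))))
            (solve 5 (λ α u A M L →
              (α :- (:1 :- α) :* u) :* A :+ ((:1 :- α) :* u :* :0 :+
                ((:1 :- α) :* u :* :0 :+ ((:1 :- α) :* u :* M :+ (:1 :- α) :* u :* L))) :=
              A :- (:1 :- α) :* (A :+ u :* (A :- (M :+ L)))) refl α u A M L)

        simplify : (ν * A + (Λ x + Λ y) - L) + N * (κ * A - (A + u * (A - (M + L)))) ≈
          N * κ * A + M + Λ x + Λ y - (A + A + A)
        simplify = trans
          (+-congˡ (trans (solve 4 (λ N T κ A → N :* (κ :* A :- T) := N :* κ :* A :- N :* T) refl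
              N (A + u * (A - (M + L))) κ A)
            (+-congˡ (-‿cong (clear-denominator A (A - (M + L)))))))
          (solve 7 (λ ν K A M L Λx Λy →
            (ν :* A :+ (Λx :+ Λy) :- L) :+ (K :* A :- ((:1 :+ (:1 :+ ν)) :* A :+ (A :- (M :+ L)))) :=
            K :* A :+ M :+ Λx :+ Λy :- (A :+ A :+ A)) refl ν (N * κ) A M L (Λ x) (Λ y))

    first-step : ∀ {x a b v} → Sides x a b → v ≢ x →
      0# ≤ ϱ x v - (ω x a + ϱ a v) ⊎ 0# ≤ ϱ x v - (ω x b + ϱ b v)
    first-step {x} {a} {b} {v} s v≢x = [ (λ h → inj₁ (0≤-resp-≈ (+-congʳ eq) h))
                                       , (λ h → inj₂ (0≤-resp-≈ (+-congʳ eq) h)) ]′ (along p)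
      where
      p = proj₁ (attained (cyc x) (cyc v))
      eq = proj₂ (attained (cyc x) (cyc v))

      via : ∀ {z} (q : Walk (cyc z) (cyc v)) → 0# ≤ ω x z + walkWeight q - (ω x z + ϱ z v)
      via {z} q = 0≤-resp-≈ (solve 3 (λ a b c → b :- c := a :+ b :- (a :+ c)) refl (ω x z) (walkWeight q) (ϱ z v))
        (≤⇒0≤- (minimal q))

      skip : ∀ {z j} (q : Walk (cyc x) (cyc v)) → 0# ≤ walkWeight q - z →
        0# ≤ leafWeight x j + (weight (leaf x j) (cyc x) + walkWeight q) - z
      skip {z} {j} q h = 0≤-resp-≈
        (solve 4 (λ a b c d → a :+ b :+ (c :- d) := a :+ (b :+ c) :- d) refl
          (leafWeight x j) (weight (leaf x j) (cyc x)) (walkWeight q) z)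
        (0≤-+ (0≤-+ (pos⇒0≤ (leafWeight-pos x j)) (pos⇒0≤ (weight-pos {leaf x j} {cyc x} ≡.refl))) h)

      along : (q : Walk (cyc x) (cyc v)) →
        0# ≤ walkWeight q - (ω x a + ϱ a v) ⊎ 0# ≤ walkWeight q - (ω x b + ϱ b v)
      along ε = contradiction ≡.refl v≢x
      along (_◅_ {j = cyc z} e q) with Sides.exhaustive s e
      ... | inj₁ ≡.refl = inj₁ (via q)
      ... | inj₂ ≡.refl = inj₂ (via q)
      along (_◅_ {j = leaf .x j} ≡.refl (_◅_ {j = cyc .x} ≡.refl q)) with along q
      ... | inj₁ h = inj₁ (skip q h)
      ... | inj₂ h = inj₂ (skip q h)

    -- Summed around the cycle, the increments of the distance from
    -- next i cancel, and the one along the edge at i is minus the distance.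
    cycle-inequality : ∀ i → 0# ≤ cycleWeight ℝ g (2 ℕ.+ n) g≥3 w - ω i (next i) - ϱ (next i) i
    cycle-inequality i = 0≤-resp-≈
        (trans (+-cong total (-‿cong (+-congˡ (-‿cong (+-congʳ (dist-refl D (cyc (next i))))))))
          (solve 3 (λ l w f → l :- (w :- (:0 :- f)) := l :- w :- f) refl
            (cycleWeight ℝ g (2 ℕ.+ n) g≥3 w) (ω i (next i)) (F i)))
        (term≤sum slack slack-0≤ i)
      where
      F : Fin g → Carrier
      F k = ϱ (next i) k

      slack : Fin g → Carrier
      slack k = ω k (next k) - (F (next k) - F k)

      slack-0≤ : ∀ k → 0# ≤ slack k
      slack-0≤ k = 0≤-resp-≈
        (trans (+-congʳ (+-congˡ (weight-sym {cyc (next k)} {cyc k} (inj₂ ≡.refl))))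
          (solve 3 (λ a b c → a :+ b :- c := b :- (c :- a)) refl (F k) (ω k (next k)) (F (next k))))
        (dist-step D {cyc (next k)} {cyc k} (cyc (next i)) (inj₂ ≡.refl))

      total : sum slack ≈ cycleWeight ℝ g (2 ℕ.+ n) g≥3 w
      total = trans (∑-distrib-- (λ k → ω k (next k)) (λ k → F (next k) - F k))
        (trans (+-congˡ (-‿cong (trans (∑-distrib-- (λ k → F (next k)) F)
          (trans (+-congʳ (sym (sum-permute F next-permutation))) (-‿inverseʳ (sum F))))))
          (solve 1 (λ a → a :- :0 := a) refl (cycleWeight ℝ g (2 ℕ.+ n) g≥3 w)))

    nonGeodesic⇒dist<weight : ∀ i → IsNonGeodesicCycleEdge ℝ g (2 ℕ.+ n) g≥3 w i →
      0# < ω i (next i) - ϱ (next i) i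
    nonGeodesic⇒dist<weight i half-L<w = <-respʳ-≈ eq
        (+-pos-0≤ (*-pos (0<fromℕ 1) (x<y⇒0<y-x half-L<w)) (cycle-inequality i))
      where
      L = cycleWeight ℝ g (2 ℕ.+ n) g≥3 w
      eq : fromℕ 2 * (ω i (next i) - 1/ 2 * L) + (L - ω i (next i) - ϱ (next i) i) ≈ ω i (next i) - ϱ (next i) i
      eq = trans (+-congʳ (trans
          (solve 4 (λ t w h L → t :* (w :- h :* L) := t :* w :- t :* h :* L) refl (fromℕ 2) (ω i (next i)) (1/ 2) L)
          (+-congˡ (-‿cong (trans (*-congʳ (1/-inverse 1)) (*-identityˡ L))))))
        (solve 3 (λ w L d → (:1 :+ (:1 :+ :0)) :* w :- L :+ (L :- w :- d) := w :- d) refl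
          (ω i (next i)) L (ϱ (next i) i))

    ϱ-pos : ∀ {x y} → cyc x ~ cyc y → 0# < ϱ x y
    ϱ-pos {x} {y} x~y = dist-pos {cyc x} {cyc y} (~⇒≢ {cyc x} {cyc y} x~y)

    geodesic-decomposition : ∀ {p q p′ q′} → Sides p q p′ → Sides q p q′ → 0# < ω p q - ϱ q p →
      0# ≤ ϱ q p - (ϱ q q′ + ϱ p p′ + ϱ q′ p′)
    geodesic-decomposition {p} {q} {p′} {q′} sp sq long = 0≤-resp-≈
        (solve 7 (λ d v m w M a b → (d :- (v :+ m)) :+ (m :- (w :+ M)) :+ ((v :- a) :+ (w :- b)) := d :- (a :+ b :+ M))
          refl (ϱ q p) (ω q q′) (ϱ q′ p) (ω p p′) (ϱ q′ p′) (ϱ q q′) (ϱ p p′))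
        (0≤-+ (0≤-+ via-q′ (0≤-resp-≈
            (+-cong (dist-sym D (cyc p) (cyc q′)) (-‿cong (+-congˡ (dist-sym D (cyc p′) (cyc q′))))) via-p′))
          (0≤-+ (dist≤weight D {cyc q} {cyc q′} (Sides.adjacentʳ sq))
                (dist≤weight D {cyc p} {cyc p′} (Sides.adjacentʳ sp))))
      where
      p≢q : p ≢ q
      p≢q p≡q = ~⇒≢ {cyc q} {cyc p} (Sides.adjacentˡ sq) (≡.cong inj₁ (≡.sym p≡q))

      q′≢p : q′ ≢ p
      q′≢p eq = Sides.distinct sq (≡.sym eq)

      via-q′ : 0# ≤ ϱ q p - (ω q q′ + ϱ q′ p)
      via-q′ = [ (λ h → contradiction
                   (trans (+-congˡ (+-congˡ (-‿cong (+-cong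
                       (weight-sym {cyc q} {cyc p} (Sides.adjacentˡ sq)) (dist-refl D (cyc p))))))
                     (solve 2 (λ w d → w :- d :+ (d :- (w :+ :0)) := :0) refl (ω p q) (ϱ q p)))
                   (pos+0≤≉0 long h))
               , id ]′ (first-step sq p≢q)

      via-p′ : 0# ≤ ϱ p q′ - (ω p p′ + ϱ p′ q′)
      via-p′ = [ (λ h → contradiction
                   (solve 5 (λ w d v a m → (w :- d) :+ ((v :+ a) :+ ((m :- (w :+ a)) :+ (d :- (v :+ m)))) := :0)
                     refl (ω p q) (ϱ q p) (ω q q′) (ϱ q q′) (ϱ q′ p))
                   (pos+0≤≉0 long (0≤-+
                     (0≤-+ (pos⇒0≤ (weight-pos {cyc q} {cyc q′} (Sides.adjacentʳ sq))) (dist-0≤ D (cyc q) (cyc q′)))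
                     (0≤-+ (0≤-resp-≈ (+-congʳ (dist-sym D (cyc p) (cyc q′))) h) via-q′))))
               , id ]′ (first-step sp q′≢p)

    next-on-geodesic : ∀ {p q p′ q′ q″} → Sides q′ q q″ → p′ ≢ q′ →
      0# ≤ ϱ q p - (ϱ q q′ + ϱ p p′ + ϱ q′ p′) → 0# ≤ ϱ q′ p′ - ϱ q′ q″
    next-on-geodesic {p} {q} {p′} {q′} {q″} sq′ p′≢q′ geodesic =
        [ (λ h → contradiction
            (solve 6 (λ w a M e b d → w :+ (a :+ ((M :- (w :+ e)) :+ (e :+ b :- d) :+ (d :- (a :+ b :+ M)))) := :0)
              refl (ω q′ q) (ϱ q q′) (ϱ q′ p′) (ϱ q p′) (ϱ p p′) (ϱ q p))
            (pos+0≤≉0 (weight-pos {cyc q′} {cyc q} (Sides.adjacentˡ sq′))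
              (0≤-+ (dist-0≤ D (cyc q) (cyc q′)) (0≤-+ (0≤-+ h
                (0≤-resp-≈ (+-congʳ (+-congˡ (dist-sym D (cyc p′) (cyc p))))
                  (dist-triangle D (cyc q) (cyc p′) (cyc p)))) geodesic))))
        , (λ h → 0≤-resp-≈
            (solve 4 (λ M w e G → M :- (w :+ e) :+ (e :+ (w :- G)) := M :- G) refl
              (ϱ q′ p′) (ω q′ q″) (ϱ q″ p′) (ϱ q′ q″))
            (0≤-+ h (0≤-+ (dist-0≤ D (cyc q″) (cyc p′))
              (dist≤weight D {cyc q′} {cyc q″} (Sides.adjacentʳ sq′)))))
        ]′ (first-step sq′ p′≢q′)

    module _ (κ : Carrier)
      (einstein : ∀ {x y} (x~y : x ~ y) → IsCurvature ℝ G D {x} {y} x~y κ) where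

      c₀ : Carrier
      c₀ = 1# + 1# + 1# + 1# - N * κ

      side-bound : ∀ {x y x′ y′} → Sides x y x′ → Sides y x y′ →
        0# ≤ c₀ * ϱ x y + ϱ y y′ - ϱ x x′ - Λ x - Λ y
      side-bound {x} {y} {x′} {y′} sx sy = 0≤-resp-≈
        (solve 7 (λ A G F Λx Λy K d →
          (A :+ A :+ A :+ G :- (F :+ Λx :+ Λy) :- K :* A) :+ (A :+ F :- d) :=
          (:1 :+ :1 :+ :1 :+ :1 :- K) :* A :+ G :- d :- Λx :- Λy)
          refl (ϱ x y) (ϱ y y′) (ϱ y x′) (Λ x) (Λ y) (N * κ) (ϱ x x′))
        (0≤-+ (cycle-edge-bound κ sx sy x~y (einstein {cyc x} {cyc y} x~y))
          (dist-triangle D (cyc x) (cyc y) (cyc x′)))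
        where x~y = Sides.adjacentˡ sx

      middle-bound : ∀ {p q p′ q′ p″ q″} → Sides p q p′ → Sides q p q′ → Sides p′ p p″ → Sides q′ q q″ →
        0# ≤ ϱ q p - (ϱ q q′ + ϱ p p′ + ϱ q′ p′) → 0# ≤ c₀ →
        0# ≤ ϱ q′ q″ + ϱ p′ p″ - (ϱ q q′ + ϱ p p′) - c₀ * ϱ q′ p′ - (Λ q′ + Λ p′)
      middle-bound {p} {q} {p′} {q′} {p″} {q″} sp sq sp′ sq′ geodesic 0≤c = 0≤-resp-≈
          (trans (+-congʳ (solve 7 (λ x y z a b d e →
              (x :- a :- d) :+ (y :- b :- e) :+ (z :+ a :+ b) := x :+ y :+ z :- (d :+ e))
              refl X Y Z (Λ q) (Λ p) (Λ q′) (Λ p′)))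
            (trans (+-congʳ (+-congʳ (+-congʳ (solve 6 (λ c a b G H d →
                (c :* a :+ G :- d) :+ (c :* b :+ H :- d) := c :* (a :+ b) :+ (G :+ H) :- d :- d)
                refl c₀ (ϱ q q′) (ϱ p p′) (ϱ q′ q″) (ϱ p′ p″) (ϱ q p)))))
              (solve 6 (λ c h G d M T →
                c :* h :+ G :- d :- d :+ (d :- c :* d :+ M) :- T :+ (:1 :+ c) :* (d :- (h :+ M)) :=
                G :- h :- c :* M :- T)
                refl c₀ (ϱ q q′ + ϱ p p′) (ϱ q′ q″ + ϱ p′ p″) (ϱ q p) (ϱ q′ p′) (Λ q′ + Λ p′))))
          (0≤-+ (0≤-+ (0≤-+
              (side-bound (Sides-swap sq) sq′)
              (0≤-resp-≈ (+-congʳ (+-congʳ (+-congˡ (-‿cong (dist-sym D (cyc p) (cyc q))))))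
                (side-bound (Sides-swap sp) sp′)))
              middle)
            (0≤-* (0≤-+ 0≤1 0≤c) geodesic))
        where
        X = c₀ * ϱ q q′ + ϱ q′ q″ - ϱ q p
        Y = c₀ * ϱ p p′ + ϱ p′ p″ - ϱ q p
        Z = ϱ q p - c₀ * ϱ q p + ϱ q′ p′
        middle : 0# ≤ Z + Λ q + Λ p
        middle = 0≤-resp-≈
          (solve 5 (λ K d M Λq Λp → K :* d :+ M :+ Λq :+ Λp :- (d :+ d :+ d) :=
            d :- (:1 :+ :1 :+ :1 :+ :1 :- K) :* d :+ M :+ Λq :+ Λp)
            refl (N * κ) (ϱ q p) (ϱ q′ p′) (Λ q) (Λ p))
          (coupled-edge-bound κ sq sp (Sides.adjacentˡ sq) (einstein {cyc q} {cyc p} (Sides.adjacentˡ sq)))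

module NoNonGeodesic {c ℓ₁ ℓ₂} (ℝ : RealNumbers c ℓ₁ ℓ₂) (g n : ℕ) (g≥3 : 3 ℕ.≤ g) where
  open Cycle
  open OrderedField ℝ
  open Transport ℝ (S g (3 ℕ.+ n) g≥3)
  open Graph (S g (3 ℕ.+ n) g≥3) using (_~_)
  open SunGraph ℝ g (suc n) g≥3

  -- With c = 4 - N κ, the quadratic form (c - 1)² + 2 ν - 1 is positive
  -- because ν = 1 + fromℕ n.
  quadratic-contradiction : ∀ {c h G M T} → 0# ≤ c → 0# < h → 0# < G → 0# ≤ M →
    0# ≤ M + M - G ⊎ G ≈ h →
    0# ≤ G - h - c * M - T → 0# ≤ c * T - ν * (h + G) → ⊥
  quadratic-contradiction {c} {h} {G} {M} {T} 0≤c 0<h 0<G 0≤M cases bound₁ bound₂ = refute cases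
    where
    bound : 0# ≤ c * (G - h - c * M) - ν * (h + G)
    bound = 0≤-resp-≈ (solve 4 (λ c x T y → c :* (x :- T) :+ (c :* T :- y) := c :* x :- y)
        refl c (G - h - c * M) T (ν * (h + G)))
      (0≤-+ (0≤-* 0≤c bound₁) bound₂)

    refute : 0# ≤ M + M - G ⊎ G ≈ h → ⊥
    refute (inj₁ G≤2M) = pos+0≤≉0 0<G
      (0≤-+ (0≤-+ (0≤-+ (0≤-* (0≤-square (c - 1#)) (pos⇒0≤ 0<G))
          (0≤-* (0≤-+ (fromℕ-0≤ n) (fromℕ-0≤ n)) (pos⇒0≤ 0<G)))
        (0≤-+ (0≤-* (0≤-+ 0≤c 0≤c) (pos⇒0≤ 0<h))
          (0≤-* (0≤-+ (fromℕ-0≤ (suc n)) (fromℕ-0≤ (suc n))) (pos⇒0≤ 0<h))))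
        (0≤-+ (0≤-+ bound bound) (0≤-* (0≤-square c) G≤2M)))
      (solve 5 (λ c h G M ν′ →
        G :+ ((c :- :1) :* (c :- :1) :* G :+ (ν′ :+ ν′) :* G
          :+ ((c :+ c) :* h :+ ((:1 :+ ν′) :+ (:1 :+ ν′)) :* h)
          :+ ((c :* (G :- h :- c :* M) :- (:1 :+ ν′) :* (h :+ G))
            :+ (c :* (G :- h :- c :* M) :- (:1 :+ ν′) :* (h :+ G))
            :+ c :* c :* (M :+ M :- G))) := :0)
        refl c h G M (fromℕ n))
    refute (inj₂ G≈h) = pos+0≤≉0 (*-pos (0<fromℕ n) (x+y-pos 0<h 0<G))
      (0≤-+ (0≤-* (0≤-square c) 0≤M) bound)
      (trans (+-congˡ (+-congˡ (+-congʳ (*-congˡ (+-congʳ (+-congʳ G≈h))))))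
        (solve 4 (λ c h M y → y :+ (c :* c :* M :+ (c :* (h :- h :- c :* M) :- y)) := :0)
          refl c h M (ν * (h + G))))

  no-Einstein : ∀ w → IsEinstein ℝ (S g (3 ℕ.+ n) g≥3) w → ∀ i → ¬ IsNonGeodesicCycleEdge ℝ g (3 ℕ.+ n) g≥3 w i
  no-Einstein w (D , κ , einstein) p non-geodesic =
      quadratic-contradiction {c = K} {T = Λ w D q′ + Λ w D p′} (pos⇒0≤ 0<K)
        (x+y-pos a-pos b-pos) (x+y-pos q″-pos p″-pos) (dist-0≤ D (cyc q′) (cyc p′))
        dichotomy
        (middle-bound w D κ (λ {x} {y} → einstein {x} {y}) sp sq sp′ sq′ geodesic (pos⇒0≤ 0<K))
        leaf-sum
    where
    d = ϱ w D
    K = c₀ w D κ (λ {x} {y} → einstein {x} {y})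
    q  = next p
    q′ = next q
    q″ = next q′
    p′ = prev p
    p″ = prev p′
    sp  = sides g≥3 p
    sq  = sides-next g≥3 p
    sq′ = sides-next g≥3 q
    sp′ = sides-prev g≥3 p

    geodesic : 0# ≤ d q p - (d q q′ + d p p′ + d q′ p′)
    geodesic = geodesic-decomposition w D sp sq (nonGeodesic⇒dist<weight w D p non-geodesic)

    a-pos : 0# < d q q′
    a-pos = ϱ-pos w D (Sides.adjacentʳ sq)
    b-pos : 0# < d p p′
    b-pos = ϱ-pos w D (Sides.adjacentʳ sp)
    q″-pos : 0# < d q′ q″
    q″-pos = ϱ-pos w D (Sides.adjacentʳ sq′)
    p″-pos : 0# < d p′ p″
    p″-pos = ϱ-pos w D (Sides.adjacentʳ sp′)

    leaves-q′ : 0# ≤ K * Λ w D q′ - ν * (d q q′ + d q′ q″)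
    leaves-q′ = 0≤-resp-≈ (+-congˡ (-‿cong (*-congˡ (+-congʳ (dist-sym D (cyc q′) (cyc q))))))
      (leaves-bound w D κ sq′ λ j → einstein {cyc q′} {leaf q′ j} ≡.refl)

    leaves-p′ : 0# ≤ K * Λ w D p′ - ν * (d p p′ + d p′ p″)
    leaves-p′ = 0≤-resp-≈ (+-congˡ (-‿cong (*-congˡ (+-congʳ (dist-sym D (cyc p′) (cyc p))))))
      (leaves-bound w D κ sp′ λ j → einstein {cyc p′} {leaf p′ j} ≡.refl)

    Λ-pos : ∀ x → 0# < Λ w D x
    Λ-pos x = +-pos-0≤ (leafWeight-pos w D x zero)
      (sum-0≤ (λ j → leafWeight w D x (suc j)) λ j → pos⇒0≤ (leafWeight-pos w D x (suc j)))

    0<K : 0# < K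
    0<K = *-cancelˡ-0< (Λ-pos q′) (<-respʳ-≈
      (solve 3 (λ K L y → y :+ (K :* L :- y) := L :* K) refl K (Λ w D q′) (ν * (d q q′ + d q′ q″)))
      (+-pos-0≤ (*-pos (0<fromℕ n) (x+y-pos a-pos q″-pos)) leaves-q′))

    leaf-sum : 0# ≤ K * (Λ w D q′ + Λ w D p′) - ν * (d q q′ + d p p′ + (d q′ q″ + d p′ p″))
    leaf-sum = 0≤-resp-≈
      (trans (solve 6 (λ K L M ν s t → (K :* L :- ν :* s) :+ (K :* M :- ν :* t) := K :* (L :+ M) :- ν :* (s :+ t))
          refl K (Λ w D q′) (Λ w D p′) ν (d q q′ + d q′ q″) (d p p′ + d p′ p″))
        (+-congˡ (-‿cong (*-congˡ (solve 4 (λ a b G H → a :+ G :+ (b :+ H) := a :+ b :+ (G :+ H))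
          refl (d q q′) (d p p′) (d q′ q″) (d p′ p″))))))
      (0≤-+ leaves-q′ leaves-p′)

    dichotomy : 0# ≤ d q′ p′ + d q′ p′ - (d q′ q″ + d p′ p″) ⊎ d q′ q″ + d p′ p″ ≈ d q q′ + d p p′
    dichotomy with q′ Fin.≟ p′
    ... | no q′≢p′ = inj₁ (0≤-resp-≈
      (solve 3 (λ M G H → M :- G :+ (M :- H) := M :+ M :- (G :+ H)) refl (d q′ p′) (d q′ q″) (d p′ p″))
      (0≤-+ (next-on-geodesic w D sq′ (λ eq → q′≢p′ (≡.sym eq)) geodesic)
        (0≤-resp-≈ (+-congʳ (dist-sym D (cyc p′) (cyc q′)))
          (next-on-geodesic w D sp′ q′≢p′ (0≤-resp-≈
            (+-cong (dist-sym D (cyc q) (cyc p)) (-‿cong (+-cong (+-comm _ _) (dist-sym D (cyc q′) (cyc p′)))))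
            geodesic)))))
    ... | yes q′≡p′ = inj₂ (trans (+-cong (reflexive (≡.cong₂ d q′≡p′ q″≡p)) (reflexive (≡.cong₂ d (≡.sym q′≡p′) p″≡q)))
        (trans (+-comm _ _) (+-cong (dist-sym D (cyc q′) (cyc q)) (dist-sym D (cyc p′) (cyc p)))))
      where
      p≢q : p ≢ q
      p≢q = next≢ g≥3 p
      q″≡p : q″ ≡ p
      q″≡p = [ (λ p≡q → contradiction p≡q p≢q) , ≡.sym ]′
        (Sides.exhaustive sq′ (≡.subst (λ x → p ≡ next x ⊎ x ≡ next p) (≡.sym q′≡p′) (Sides.adjacentˡ sp′)))
      p″≡q : p″ ≡ q
      p″≡q = [ (λ q≡p → contradiction (≡.sym q≡p) p≢q) , ≡.sym ]′
        (Sides.exhaustive sp′ (≡.subst (λ x → q ≡ next x ⊎ x ≡ next q) q′≡p′ (Sides.adjacentˡ sq′)))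

open import Data.Nat.Base using (_≤_)

proposition7p10 : ∀ {c ℓ₁ ℓ₂} (ℝ : RealNumbers c ℓ₁ ℓ₂) (g d : ℕ) (g≥3 : 3 ≤ g) → 3 ≤ d →
    ¬ (∃[ w ] (IsEinstein ℝ (S g d g≥3) w × ∃[ i ] IsNonGeodesicCycleEdge ℝ g d g≥3 w i))
proposition7p10 ℝ g (suc (suc (suc n))) g≥3 (ℕ.s≤s (ℕ.s≤s (ℕ.s≤s _))) (w , einstein , i , non-geodesic) =
  NoNonGeodesic.no-Einstein ℝ g n g≥3 w einstein i non-geodesic
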